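{- Let $G_1$ be the graph with edges $\{1,3\},\{1,5\},\{2,3\},\{2,4\}$. Then (1) $n\log n\ll\mathrm{ex}_e(G_1,n)\ll n(\log n)^2(\log\log n)^3$; (2) $n\log n\ll\mathrm{ex}_i(G_1,n)\ll n(\log n)^2(\log\log n)^3$.
   Context: A hypergraph $H=(E_i: i\in I)$ is a finite list of finite nonempty subsets of $\mathbb{N}$; it is simple if its edges are pairwise distinct. $v(H)=|\bigcup_i E_i|$, $e(H)=|I|$, $i(H)=\sum_i|E_i|$. $H$ contains $H'=(E'_i:i\in I')$ ($H\succ H'$) if there exist an increasing injection $\phi:\bigcup H'\to\bigcup H$ and an injection $f:I'\to I$ with $v\in E'_i\Rightarrow \phi(v)\in E_{f(i)}$. $\mathrm{ex}_e(F,n)=\max\{e(H): H\not\succ F,\ H\text{ simple},\ v(H)\le n\}$, $\mathrm{ex}_i(F,n)=\max\{i(H): H\not\succ F,\ H\text{ simple},\ v(H)\le n\}$. $f\ll g$ means $|f(n)|<c|g(n)|$ for some constant $c>0$ and all large $n$. -}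

module Defs where

open import Data.Nat using (ℕ; _+_; _*_; _^_; _≤_; _<_; _≥_)
open import Data.Nat.Properties using (_≟_)
open import Data.Nat.Logarithm using (⌊log₂_⌋)
open import Data.List using (List; []; _∷_; length; concat; deduplicate; map; lookup)
open import Data.Nat.ListAction using (sum)
open import Data.List.Membership.Propositional using (_∈_)
open import Data.List.Relation.Unary.All using (All)
open import Data.List.Relation.Unary.Linked using (Linked)
open import Data.List.Relation.Unary.Unique.Propositional using (Unique)
open import Data.Fin using (Fin)
open import Data.Product using (Σ; ∃; _×_; ∃-syntax)
open import Function.Definitions using (Injective)
open import Relation.Binary.PropositionalEquality using (_≡_)

-- A finite nonempty subset of ℕ is represented canonically as a
-- nonempty strictly increasing list (so set equality = list equality,
-- and cardinality = length).
Edge : Set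
Edge = List ℕ

data NonEmpty : List ℕ → Set where
  nonEmpty : ∀ {x xs} → NonEmpty (x ∷ xs)

IsEdge : Edge → Set
IsEdge E = NonEmpty E × Linked _<_ E

-- A hypergraph is a finite list of edges (E_i : i ∈ I), I = Fin (length H).
Hypergraph : Set
Hypergraph = List Edge

WellFormed : Hypergraph → Set
WellFormed H = All IsEdge H

Simple : Hypergraph → Set
Simple H = Unique H

vtx : Hypergraph → ℕ
vtx H = length (deduplicate _≟_ (concat H))

edg : Hypergraph → ℕ
edg H = length H

inc : Hypergraph → ℕ
inc H = sum (map length H)

_∈V_ : ℕ → Hypergraph → Set
v ∈V H = v ∈ concat H

_≻_ : Hypergraph → Hypergraph → Set
H ≻ H' =
  Σ (ℕ → ℕ) λ φ → Σ (Fin (length H') → Fin (length H)) λ f →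
    (∀ u v → u ∈V H' → v ∈V H' → u < v → φ u < φ v) ×
    (∀ u → u ∈V H' → φ u ∈V H) ×
    Injective _≡_ _≡_ f ×
    (∀ i v → v ∈ lookup H' i → φ v ∈ lookup H (f i))

Admissible : Hypergraph → ℕ → Hypergraph → Set
Admissible F n H = WellFormed H × Simple H × vtx H ≤ n × (H ≻ F → Data.Empty.⊥)
  where import Data.Empty

IsMaxOf : (Hypergraph → ℕ) → Hypergraph → ℕ → ℕ → Set
IsMaxOf w F n m =
  (∃[ H ] (Admissible F n H × w H ≡ m)) ×
  (∀ H → Admissible F n H → w H ≤ m)

IsExE : Hypergraph → ℕ → ℕ → Set
IsExE = IsMaxOf edg

IsExI : Hypergraph → ℕ → ℕ → Set
IsExI = IsMaxOf inc

-- f ≪ g : ∃ c > 0, ∀ large n, |f n| < c |g n|  (values in ℕ; c may be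
-- taken to be a natural number)
_≪_ : (ℕ → ℕ) → (ℕ → ℕ) → Set
f ≪ g = ∃[ c ] ∃[ N ] (∀ n → n ≥ N → f n < c * g n)

-- logarithms (base 2, floor); equivalent to ln up to constants for large n
lg : ℕ → ℕ
lg n = ⌊log₂ n ⌋

G₁ : Hypergraph
G₁ = (1 ∷ 3 ∷ []) ∷ (1 ∷ 5 ∷ []) ∷ (2 ∷ 3 ∷ []) ∷ (2 ∷ 4 ∷ []) ∷ []

nlogn : ℕ → ℕ
nlogn n = n * lg n

upperFn : ℕ → ℕ
upperFn n = n * lg n ^ 2 * lg (lg n) ^ 3

{-# OPTIONS --safe #-}

-- Upper bounds.  For an edge (a , b) of an ordered G₁-free graph, compare the distance from b to
-- the next neighbour of a with the distance to the last one.  If the former is at most half of the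
-- latter, then for fixed b the distance to the last neighbour of a doubles with growing a; if
-- not, it halves when b moves to the next neighbour of a.  So every vertex is charged O(log n)
-- edges, and the graph has O(n log n) of them.  In a hypergraph H choose greedily distinct pairs
-- in distinct edges: these pairs form a G₁-free graph G, and all other edges are cliques of G.  G is
-- O(log n)-degenerate, so removing a vertex of small degree, over and over, bounds the number of
-- cliques by n T(O(log n)), whence T(n) ≤ O(n log n) + n T(O(log n)) for the extremal function T.
-- This first gives T(m) = O(m²), and then T(n) = O(n log² n).  Incidences are reduced to edges by
-- cutting every edge into consecutive blocks of five vertices.
--
-- Lower bound.  The bipartite graph joining x < 2h to 2h + y (y < h) whenever x − y is a power of
-- two is G₁-free: of two neighbours of a common a₃, the one farther left has all its neighbours
-- beyond a₃ nearer to a₃ than those of the other one.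
module Submission where

open import Defs
open import Data.Bool using (Bool; true; false)
open import Data.Empty using (⊥; ⊥-elim)
open import Data.Fin using (Fin) renaming (zero to fzero; suc to fsuc)
open import Data.List
  using (List; []; _∷_; _++_; [_]; length; map; filter; upTo; cartesianProduct; deduplicate;
         concat; concatMap; lookup)
open import Data.List.Membership.Propositional using (_∈_; _∉_; find; lose)
open import Data.List.Membership.Propositional.Properties
  using (∈-∃++; ∈-++⁺ˡ; ∈-++⁺ʳ; ∈-++⁻; ∈-map⁺; ∈-map⁻; ∈-filter⁺; ∈-filter⁻; ∈-upTo⁺; ∈-upTo⁻;
         ∈-lookup; ∈-concat⁺′; ∈-concat⁻′; ∈-concatMap⁺; ∈-concatMap⁻; ∈-cartesianProduct⁺;
         ∈-cartesianProduct⁻; ∈-deduplicate⁺; ∈-deduplicate⁻)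
import Data.List.Membership.DecPropositional as Member
open import Data.List.Properties as List
  using (length-map; length-++; length-++-sucʳ; length-upTo; length-filter; filter-notAll)
open import Data.List.Relation.Unary.All as All using (All; []; _∷_)
open import Data.List.Relation.Unary.AllPairs using (AllPairs; []; _∷_)
import Data.List.Relation.Unary.AllPairs.Properties as AllPairs
open import Data.List.Relation.Unary.Any as Any using (Any; here; there; any?)
open import Data.List.Relation.Unary.Any.Properties using (lookup-index)
open import Data.List.Relation.Unary.Linked using ([-]; _∷_)
open import Data.List.Relation.Unary.Linked.Properties using (Linked⇒AllPairs)
open import Data.List.Relation.Unary.Unique.Propositional using (Unique)
open import Data.List.Relation.Unary.Unique.Propositional.Properties
  using (filter⁺; map⁺; cartesianProduct⁺; upTo⁺)
import Data.List.Relation.Unary.Unique.DecPropositional.Properties as Dedup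
open import Data.Nat hiding (_≟_; _≥_)
open import Data.Nat.DivMod using (m/n*n≤m; m%n<n; m≡m%n+[m/n]*n; m≥n⇒m/n>0)
open import Data.Nat.Induction using (<-rec)
open import Data.Nat.ListAction using (sum)
open import Data.Nat.Logarithm
open import Data.Nat.Properties
open import Data.List.Extrema ≤-totalOrder using (max; xs≤max; argmax-sel)
open import Data.List.Membership.DecPropositional _≟_ using (_∈?_)
open import Data.Nat.Solver using (module +-*-Solver)
open import Data.Product using (_×_; _,_; proj₁; proj₂; ∃-syntax)
open import Data.Product.Properties using (,-injective; ≡-dec)
open import Data.Sum using (_⊎_; inj₁; inj₂)
open import Function using (_∘_; id)
open import Relation.Binary.Definitions using (tri<; tri≈; tri>)
open import Relation.Binary.PropositionalEquality hiding ([_])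
open import Relation.Nullary using (Dec; yes; no; ¬_)
open import Relation.Nullary.Decidable
  using (_×-dec_; _⊎-dec_; ¬?; decidable-stable; from-yes; True; toWitness)
open import Relation.Unary using () renaming (Decidable to Decidable₁)

private
  variable
    A B : Set

-- Lists and counting

unique-⊆⇒length-≤ : {xs ys : List A} → Unique xs → (∀ {x} → x ∈ xs → x ∈ ys) →
                    length xs ≤ length ys
unique-⊆⇒length-≤ {xs = []} _ _ = z≤n
unique-⊆⇒length-≤ {xs = x ∷ xs} (x∉ ∷ u) xs⊆ys
  with as , bs , refl ← ∈-∃++ (xs⊆ys (here refl)) =
  ≤-trans (s≤s (unique-⊆⇒length-≤ u sub)) (≤-reflexive (sym (length-++-sucʳ as x bs)))
  where
  sub : ∀ {y} → y ∈ xs → y ∈ as ++ bs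
  sub y∈xs with ∈-++⁻ as (xs⊆ys (there y∈xs))
  ... | inj₁ y∈as = ∈-++⁺ˡ y∈as
  ... | inj₂ (here refl) = ⊥-elim (All.lookup x∉ y∈xs refl)
  ... | inj₂ (there y∈bs) = ∈-++⁺ʳ as y∈bs

unique-map : (f : A → B) {xs : List A} → (∀ {x y} → x ∈ xs → y ∈ xs → f x ≡ f y → x ≡ y) →
             Unique xs → Unique (map f xs)
unique-map f inj [] = []
unique-map f {x ∷ xs} inj (x∉ ∷ u) =
  All.tabulate fresh ∷ unique-map f (λ p q → inj (there p) (there q)) u
  where
  fresh : ∀ {z} → z ∈ map f xs → f x ≢ z
  fresh z∈ eq with y , y∈ , refl ← ∈-map⁻ f z∈ = All.lookup x∉ y∈ (inj (here refl) (there y∈) eq)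

injection⇒length-≤ : (f : A → B) {xs : List A} {ys : List B} → Unique xs →
  (∀ {x y} → x ∈ xs → y ∈ xs → f x ≡ f y → x ≡ y) → (∀ {x} → x ∈ xs → f x ∈ ys) →
  length xs ≤ length ys
injection⇒length-≤ f {xs} u inj into =
  subst (_≤ _) (length-map f xs)
    (unique-⊆⇒length-≤ (unique-map f inj u)
      λ z∈ → let y , y∈ , z≡ = ∈-map⁻ f z∈ in subst (_∈ _) (sym z≡) (into y∈))

length-cartesianProduct : (xs : List A) (ys : List B) →
                          length (cartesianProduct xs ys) ≡ length xs * length ys
length-cartesianProduct [] ys = refl
length-cartesianProduct (x ∷ xs) ys =
  trans (length-++ (map (x ,_) ys))
        (cong₂ _+_ (length-map (x ,_) ys) (length-cartesianProduct xs ys))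

module _ {P : A → Set} (P? : Decidable₁ P) where

  length-filter-split : ∀ xs →
    length xs ≡ length (filter P? xs) + length (filter (λ x → ¬? (P? x)) xs)
  length-filter-split [] = refl
  length-filter-split (x ∷ xs) with P? x
  ... | yes _ = cong suc (length-filter-split xs)
  ... | no _ = trans (cong suc (length-filter-split xs)) (sym (+-suc _ _))

module _ {P Q : A → Set} (P? : Decidable₁ P) (Q? : Decidable₁ Q) (P⇒Q : ∀ {x} → P x → Q x) where

  length-filter-mono : ∀ xs → length (filter P? xs) ≤ length (filter Q? xs)
  length-filter-mono [] = z≤n
  length-filter-mono (x ∷ xs) with P? x | Q? x
  ... | yes _ | yes _ = s≤s (length-filter-mono xs)
  ... | yes p | no ¬q = ⊥-elim (¬q (P⇒Q p))
  ... | no _ | yes _ = m≤n⇒m≤1+n (length-filter-mono xs)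
  ... | no _ | no _ = length-filter-mono xs

  length-filter-strict : ∀ {x xs} → x ∈ xs → ¬ P x → Q x →
                         length (filter P? xs) < length (filter Q? xs)
  length-filter-strict {xs = x ∷ xs} (here refl) ¬p q with P? x | Q? x
  ... | yes p | _ = ⊥-elim (¬p p)
  ... | no _ | yes _ = s≤s (length-filter-mono xs)
  ... | no _ | no ¬q = ⊥-elim (¬q q)
  length-filter-strict {xs = y ∷ xs} (there x∈) ¬p q with P? y | Q? y
  ... | yes _ | yes _ = s≤s (length-filter-strict x∈ ¬p q)
  ... | yes p | no ¬q = ⊥-elim (¬q (P⇒Q p))
  ... | no _ | yes _ = m≤n⇒m≤1+n (length-filter-strict x∈ ¬p q)
  ... | no _ | no _ = length-filter-strict x∈ ¬p q

module _ {R : A → B → Set} (R? : ∀ x y → Dec (R x y)) where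

  private
    row : A → List B → ℕ
    row x ys = length (filter (R? x) ys)

    col : B → List A → ℕ
    col y xs = length (filter (λ x → R? x y) xs)

    col-∷ : ∀ x xs ys → sum (map (λ y → col y (x ∷ xs)) ys) ≡ row x ys + sum (map (λ y → col y xs) ys)
    col-∷ x xs [] = refl
    col-∷ x xs (y ∷ ys) with R? x y
    ... | no _ = trans (cong (col y xs +_) (col-∷ x xs ys))
      (solve 3 (λ a b c → a :+ (b :+ c) := b :+ (a :+ c)) refl (col y xs) (row x ys) _)
      where open +-*-Solver
    ... | yes _ = cong suc (trans (cong (col y xs +_) (col-∷ x xs ys))
      (solve 3 (λ a b c → a :+ (b :+ c) := b :+ (a :+ c)) refl (col y xs) (row x ys) _))
      where open +-*-Solver

    col-[] : ∀ ys → sum (map (λ y → col y []) ys) ≡ 0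
    col-[] [] = refl
    col-[] (_ ∷ ys) = col-[] ys

  double-counting : ∀ xs ys →
    sum (map (λ x → length (filter (R? x) ys)) xs) ≡
    sum (map (λ y → length (filter (λ x → R? x y) xs)) ys)
  double-counting [] ys = sym (col-[] ys)
  double-counting (x ∷ xs) ys =
    trans (cong (row x ys +_) (double-counting xs ys)) (sym (col-∷ x xs ys))

sum-map-≤ : (f : A → ℕ) (k : ℕ) (xs : List A) → (∀ {x} → x ∈ xs → f x ≤ k) →
            sum (map f xs) ≤ k * length xs
sum-map-≤ f k [] _ = z≤n
sum-map-≤ f k (x ∷ xs) f≤k =
  ≤-trans (+-mono-≤ (f≤k (here refl)) (sum-map-≤ f k xs (f≤k ∘ there)))
          (≤-reflexive (sym (*-suc k (length xs))))

-- Averaging: a head above `k` takes at least `suc k` out of the sum, so the strict inequality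
-- passes to the tail.
sum-map-<⇒∃≤ : (f : A → ℕ) (k : ℕ) (xs : List A) → sum (map f xs) < suc k * length xs →
               ∃[ x ] (x ∈ xs × f x ≤ k)
sum-map-<⇒∃≤ f k [] sum< = ⊥-elim (n≮0 (subst (0 <_) (*-zeroʳ (suc k)) sum<))
sum-map-<⇒∃≤ f k (x ∷ xs) sum< with f x ≤? k
... | yes fx≤k = x , here refl , fx≤k
... | no fx≰k with y , y∈ , fy≤k ← sum-map-<⇒∃≤ f k xs
                     (+-cancelˡ-< (suc k) _ _
                       (≤-<-trans (+-monoˡ-≤ _ (≰⇒> fx≰k))
                                  (subst (f x + sum (map f xs) <_) (*-suc (suc k) (length xs)) sum<)))
  = y , there y∈ , fy≤k

-- Shifted by one from ⌊log₂_⌋, which is 0 at 0, in order to separate 0 from 1.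
level : ℕ → ℕ
level zero = 0
level w@(suc _) = suc ⌊log₂ w ⌋

-- Doubling adds one to the logarithm; for `w = 0` it is `1 ≤ w′` that lifts the level from zero.
level-double : ∀ w w′ → 1 ≤ w′ → 2 * w ≤ w′ → level w < level w′
level-double zero (suc w′) _ _ = s≤s z≤n
level-double w@(suc _) w′@(suc _) _ 2w≤w′ =
  s≤s (≤-trans (≤-reflexive (sym (⌊log₂[2*b]⌋≡1+⌊log₂b⌋ w))) (⌊log₂⌋-mono-≤ 2w≤w′))

level-≤ : ∀ {w n} → w ≤ n → level w < 2 + ⌊log₂ n ⌋
level-≤ {zero} _ = s≤s z≤n
level-≤ {suc w} w≤n = s≤s (s≤s (⌊log₂⌋-mono-≤ w≤n))

-- Distances are measured in ranks, because vertex names are arbitrary numbers whereas only the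
-- number of vertices may enter the logarithm.
rank : List ℕ → ℕ → ℕ
rank V x = length (filter (_<? x) V)

rank-≤ : ∀ V x → rank V x ≤ length V
rank-≤ V x = length-filter (_<? x) V

rank-mono : ∀ V {x y} → x ≤ y → rank V x ≤ rank V y
rank-mono V {x} {y} x≤y = length-filter-mono (_<? x) (_<? y) (λ v<x → <-≤-trans v<x x≤y) V

rank-strict : ∀ V {x y} → x ∈ V → x < y → rank V x < rank V y
rank-strict V {x} {y} x∈ x<y =
  length-filter-strict (_<? x) (_<? y) (λ v<x → <-trans v<x x<y) x∈ (<-irrefl refl) x<y

-- Ordered graphs

-- The strict order of the vertices makes the four pairs distinct, which `Free` has to demand of its
-- four edges.
GraphFree : List (ℕ × ℕ) → Set
GraphFree G = ∀ {a₁ a₂ a₃ a₄ a₅} → a₁ < a₂ → a₂ < a₃ → a₃ < a₄ → a₄ < a₅ →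
  (a₁ , a₃) ∈ G → (a₁ , a₅) ∈ G → (a₂ , a₃) ∈ G → (a₂ , a₄) ∈ G → ⊥

IsGraphOn : List ℕ → List (ℕ × ℕ) → Set
IsGraphOn V G = ∀ {a b} → (a , b) ∈ G → a ∈ V × b ∈ V × a < b

neighbours : List (ℕ × ℕ) → ℕ → List ℕ
neighbours G a = map proj₂ (filter (λ e → proj₁ e ≟ a) G)

∈-neighbours⁺ : ∀ {G a b} → (a , b) ∈ G → b ∈ neighbours G a
∈-neighbours⁺ {a = a} e∈ = ∈-map⁺ proj₂ (∈-filter⁺ (λ e → proj₁ e ≟ a) e∈ refl)

∈-neighbours⁻ : ∀ {G a b} → b ∈ neighbours G a → (a , b) ∈ G
∈-neighbours⁻ {G} {a} b∈ with (_ , _) , e∈ , refl ← ∈-map⁻ proj₂ b∈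
                         with e∈G , refl ← ∈-filter⁻ (λ e → proj₁ e ≟ a) e∈ = e∈G

max-∈ : ∀ {x xs} → x ∈ xs → max 0 xs ∈ xs
max-∈ {x} {xs} x∈ with argmax-sel id 0 xs
... | inj₂ m∈ = m∈
-- The maximum may be the default 0; then every element is 0, so the default coincides with `x`.
... | inj₁ m≡0 = subst (_∈ xs) (trans x≡0 (sym m≡0)) x∈
  where
  x≡0 : x ≡ 0
  x≡0 = n≤0⇒n≡0 (subst (x ≤_) m≡0 (All.lookup (xs≤max 0 xs) x∈))

module _ (V : List ℕ) (G : List (ℕ × ℕ)) (on : IsGraphOn V G) (free : GraphFree G) where

  private
    top : ℕ → ℕ
    top a = max 0 (neighbours G a)

    ≤top : ∀ {a b} → (a , b) ∈ G → b ≤ top a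
    ≤top {a} e∈ = All.lookup (xs≤max 0 (neighbours G a)) (∈-neighbours⁺ e∈)

    top∈ : ∀ {a b} → (a , b) ∈ G → (a , top a) ∈ G
    top∈ e∈ = ∈-neighbours⁻ (max-∈ (∈-neighbours⁺ e∈))

    r : ℕ → ℕ
    r = rank V

    room : ℕ × ℕ → ℕ
    room (a , b) = r (top a) ∸ r b

    -- Some neighbour `c` has this property exactly when the neighbour following `b` has it, since
    -- ranks are monotone; this avoids picking out the next neighbour.
    Crowded : ℕ × ℕ → ℕ → Set
    Crowded e@(a , b) c = b < c × 2 * (r c ∸ r b) ≤ room e

    crowded? : ∀ e → Dec (Any (Crowded e) (neighbours G (proj₁ e)))
    crowded? e@(a , b) = any? (λ c → (b <? c) ×-dec (2 * (r c ∸ r b) ≤? room e)) (neighbours G a)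

    -- A crowded edge is charged to its right end, any other edge to its left end.
    key : ℕ × ℕ → ℕ × (Bool × ℕ)
    key e@(a , b) with crowded? e
    ... | yes _ = b , true , level (room e)
    ... | no _ = a , false , level (room e)

    -- The neighbour c of a₂ following b cannot precede the last neighbour of a₁.
    crowded-room : ∀ {a₁ a₂ b} → (a₁ , b) ∈ G → (a₂ , b) ∈ G → a₁ < a₂ →
      Any (Crowded (a₁ , b)) (neighbours G a₁) → Any (Crowded (a₂ , b)) (neighbours G a₂) →
      level (room (a₁ , b)) < level (room (a₂ , b))
    crowded-room {a₁} {a₂} {b} e₁ e₂ a₁<a₂ cr₁ cr₂
      with c₁ , c₁∈ , b<c₁ , _ ← find cr₁
         | c₂ , c₂∈ , b<c₂ , 2gap≤ ← find cr₂ =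
      level-double _ _ (≤-trans 1≤room₁ (≤-trans (m≤n*m _ 2) 2room≤)) 2room≤
      where
      top≤c₂ : top a₁ ≤ c₂
      top≤c₂ with top a₁ ≤? c₂
      ... | yes p = p
      ... | no p = ⊥-elim (free a₁<a₂ (proj₂ (proj₂ (on e₂))) b<c₂ (≰⇒> p)
                            e₁ (top∈ e₁) e₂ (∈-neighbours⁻ c₂∈))
      2room≤ : 2 * room (a₁ , b) ≤ room (a₂ , b)
      2room≤ = ≤-trans (*-monoʳ-≤ 2 (∸-monoˡ-≤ (r b) (rank-mono V top≤c₂))) 2gap≤
      1≤room₁ : 1 ≤ room (a₁ , b)
      1≤room₁ = m<n⇒0<n∸m (rank-strict V (proj₁ (proj₂ (on e₁)))
                             (<-≤-trans b<c₁ (≤top (∈-neighbours⁻ c₁∈))))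

    -- The gap from `b₁` to `b₂` takes up more than half of the room at `b₁`, so less than half of
    -- it is left at `b₂`.
    uncrowded-room : ∀ {a b₁ b₂} → (a , b₁) ∈ G → (a , b₂) ∈ G → b₁ < b₂ →
      ¬ Any (Crowded (a , b₁)) (neighbours G a) → level (room (a , b₂)) < level (room (a , b₁))
    uncrowded-room {a} {b₁} {b₂} e₁ e₂ b₁<b₂ ¬cr = level-double _ _ 1≤room 2room≤
      where
      r₁<r₂ : r b₁ < r b₂
      r₁<r₂ = rank-strict V (proj₁ (proj₂ (on e₁))) b₁<b₂
      r₂≤top : r b₂ ≤ r (top a)
      r₂≤top = rank-mono V (≤top e₂)
      1≤room : 1 ≤ room (a , b₁)
      1≤room = m<n⇒0<n∸m (<-≤-trans r₁<r₂ r₂≤top)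
      far : room (a , b₁) < 2 * (r b₂ ∸ r b₁)
      far = ≰⇒> λ near → ¬cr (lose (∈-neighbours⁺ e₂) (b₁<b₂ , near))
      split : room (a , b₁) ≡ room (a , b₂) + (r b₂ ∸ r b₁)
      split = trans (cong (_∸ r b₁) (sym (m∸n+n≡m r₂≤top))) (+-∸-assoc (room (a , b₂)) (<⇒≤ r₁<r₂))
      room<gap : room (a , b₂) < r b₂ ∸ r b₁
      room<gap = +-cancelʳ-< (r b₂ ∸ r b₁) _ _
        (subst₂ _<_ split (cong ((r b₂ ∸ r b₁) +_) (+-identityʳ _)) far)
      2room≤ : 2 * room (a , b₂) ≤ room (a , b₁)
      2room≤ = subst (_≤ room (a , b₁)) (cong (room (a , b₂) +_) (sym (+-identityʳ _)))
        (subst (room (a , b₂) + room (a , b₂) ≤_) (sym split) (+-monoʳ-≤ _ (<⇒≤ room<gap)))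

    -- Equal keys mean the same kind of edge, a common end and equal levels. At a common right end
    -- the levels of crowded edges strictly increase with the left end; at a common left end those
    -- of the other edges strictly decrease with the right end.
    key-injective : ∀ {e e′} → e ∈ G → e′ ∈ G → key e ≡ key e′ → e ≡ e′
    key-injective {a , b} {a′ , b′} e∈ e∈′ eq with crowded? (a , b) | crowded? (a′ , b′)
    key-injective {a , b} {a′ , b′} e∈ e∈′ eq | yes cr | yes cr′
      with refl , eq′ ← ,-injective eq with _ , leq ← ,-injective eq′ with <-cmp a a′
    ... | tri< a<a′ _ _ = ⊥-elim (<-irrefl leq (crowded-room e∈ e∈′ a<a′ cr cr′))
    ... | tri≈ _ refl _ = refl
    ... | tri> _ _ a′<a = ⊥-elim (<-irrefl (sym leq) (crowded-room e∈′ e∈ a′<a cr′ cr))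
    key-injective {a , b} {a′ , b′} e∈ e∈′ eq | no ¬cr | no ¬cr′
      with refl , eq′ ← ,-injective eq with _ , leq ← ,-injective eq′ with <-cmp b b′
    ... | tri< b<b′ _ _ = ⊥-elim (<-irrefl (sym leq) (uncrowded-room e∈ e∈′ b<b′ ¬cr))
    ... | tri≈ _ refl _ = refl
    ... | tri> _ _ b′<b = ⊥-elim (<-irrefl leq (uncrowded-room e∈′ e∈ b′<b ¬cr′))
    key-injective e∈ e∈′ () | yes _ | no _
    key-injective e∈ e∈′ () | no _ | yes _

    bools : List Bool
    bools = true ∷ false ∷ []

    levels : List ℕ
    levels = upTo (2 + ⌊log₂ length V ⌋)

    colours : List (Bool × ℕ)
    colours = cartesianProduct bools levels

    colour∈ : ∀ x e → x ∈ bools → (x , level (room e)) ∈ colours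
    colour∈ x (a , b) x∈ = ∈-cartesianProduct⁺ x∈
      (∈-upTo⁺ (level-≤ (≤-trans (m∸n≤m (r (top a)) (r b)) (rank-≤ V (top a)))))

    key∈ : ∀ {e} → e ∈ G → key e ∈ cartesianProduct V colours
    key∈ {e@(a , b)} e∈ with crowded? (a , b)
    ... | yes _ = ∈-cartesianProduct⁺ (proj₁ (proj₂ (on e∈))) (colour∈ true e (here refl))
    ... | no _ = ∈-cartesianProduct⁺ (proj₁ (on e∈)) (colour∈ false e (there (here refl)))

  -- Each vertex is charged at most once for each of the two kinds of edges and each of the
  -- `2 + ⌊log₂ length V ⌋` levels.
  graph-size : Unique G → length G ≤ length V * (2 * (2 + ⌊log₂ length V ⌋))
  graph-size u = subst (length G ≤_)
    (trans (length-cartesianProduct V colours)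
      (cong (length V *_) (trans (length-cartesianProduct bools levels) (cong (2 *_) (length-upTo (2 + ⌊log₂ length V ⌋))))))
    (injection⇒length-≤ key u key-injective key∈)

-- Hypergraphs and links

Sorted : List ℕ → Set
Sorted = AllPairs _<_

sorted-ext : ∀ {xs ys} → Sorted xs → Sorted ys →
             (∀ {x} → x ∈ xs → x ∈ ys) → (∀ {x} → x ∈ ys → x ∈ xs) → xs ≡ ys
sorted-ext {[]} {[]} _ _ _ _ = refl
sorted-ext {[]} {_ ∷ _} _ _ _ ys⊆xs with () ← ys⊆xs (here refl)
sorted-ext {_ ∷ _} {[]} _ _ xs⊆ys _ with () ← xs⊆ys (here refl)
sorted-ext {x ∷ xs} {y ∷ ys} (x< ∷ sxs) (y< ∷ sys) xs⊆ys ys⊆xs =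
  cong₂ _∷_ x≡y (sorted-ext sxs sys (tail x< x≡y xs⊆ys) (tail y< (sym x≡y) ys⊆xs))
  where
  x≡y : x ≡ y
  x≡y with xs⊆ys (here refl) | ys⊆xs (here refl)
  ... | here eq | _ = eq
  ... | there _ | here eq = sym eq
  ... | there x∈ys | there y∈xs = ⊥-elim (<-asym (All.lookup y< x∈ys) (All.lookup x< y∈xs))
  tail : ∀ {a b as bs} → All (a <_) as → a ≡ b → (∀ {w} → w ∈ a ∷ as → w ∈ b ∷ bs) →
         ∀ {w} → w ∈ as → w ∈ bs
  tail a< refl sub w∈ with sub (there w∈)
  ... | here refl = ⊥-elim (<-irrefl refl (All.lookup a< w∈))
  ... | there w∈bs = w∈bs

-- Avoidance of `G₁` with vertices and edges named outright; distinctness of the four edges stands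
-- for the injective index map.
Free : Hypergraph → Set
Free H = ∀ {a₁ a₂ a₃ a₄ a₅ E₁ E₂ E₃ E₄} → a₁ < a₂ → a₂ < a₃ → a₃ < a₄ → a₄ < a₅ →
  E₁ ∈ H → E₂ ∈ H → E₃ ∈ H → E₄ ∈ H →
  a₁ ∈ E₁ → a₃ ∈ E₁ → a₁ ∈ E₂ → a₅ ∈ E₂ → a₂ ∈ E₃ → a₃ ∈ E₃ → a₂ ∈ E₄ → a₄ ∈ E₄ →
  Unique (E₁ ∷ E₂ ∷ E₃ ∷ E₄ ∷ []) → ⊥

-- Fails as soon as one of the two sets lies entirely before the other, as with two different blocks
-- of the same edge.
Interleaved : Edge → Edge → Set
Interleaved E E′ = ∃[ x ] ∃[ y ] ∃[ x′ ] ∃[ y′ ]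
  (x ∈ E × y ∈ E × x′ ∈ E′ × y′ ∈ E′ × x < y′ × x′ < y)

module _ {H H′ : Hypergraph}
  (lift : ∀ {E} → E ∈ H′ → ∃[ F ] (F ∈ H × (∀ {x} → x ∈ E → x ∈ F)))
  (lift-≢ : ∀ {E E′} (p : E ∈ H′) (p′ : E′ ∈ H′) → E ≢ E′ → Interleaved E E′ →
            proj₁ (lift p) ≢ proj₁ (lift p′)) where

  -- Any two edges of G₁ are interleaved, whence the restriction in lift-≢.
  free-transfer : Free H → Free H′
  free-transfer free {a₁} {a₂} {a₃} {a₄} {a₅} 1<2 2<3 3<4 4<5 e₁ e₂ e₃ e₄ 1∈ 3∈ 1∈′ 5∈ 2∈ 3∈′ 2∈′ 4∈
    ((n₁₂ ∷ n₁₃ ∷ n₁₄ ∷ []) ∷ (n₂₃ ∷ n₂₄ ∷ []) ∷ (n₃₄ ∷ []) ∷ [] ∷ []) =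
    free 1<2 2<3 3<4 4<5 (in-H e₁) (in-H e₂) (in-H e₃) (in-H e₄)
      (⊆ e₁ 1∈) (⊆ e₁ 3∈) (⊆ e₂ 1∈′) (⊆ e₂ 5∈) (⊆ e₃ 2∈) (⊆ e₃ 3∈′) (⊆ e₄ 2∈′) (⊆ e₄ 4∈)
      ((lift-≢ e₁ e₂ n₁₂ (_ , _ , _ , _ , 1∈ , 3∈ , 1∈′ , 5∈ , <-trans 1<3 3<5 , 1<3) ∷
        lift-≢ e₁ e₃ n₁₃ (_ , _ , _ , _ , 1∈ , 3∈ , 2∈ , 3∈′ , 1<3 , 2<3) ∷
        lift-≢ e₁ e₄ n₁₄ (_ , _ , _ , _ , 1∈ , 3∈ , 2∈′ , 4∈ , <-trans 1<3 3<4 , 2<3) ∷ []) ∷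
       (lift-≢ e₂ e₃ n₂₃ (_ , _ , _ , _ , 1∈′ , 5∈ , 2∈ , 3∈′ , 1<3 , <-trans 2<3 3<5) ∷
        lift-≢ e₂ e₄ n₂₄ (_ , _ , _ , _ , 1∈′ , 5∈ , 2∈′ , 4∈ , <-trans 1<3 3<4 , <-trans 2<3 3<5) ∷ []) ∷
       (lift-≢ e₃ e₄ n₃₄ (_ , _ , _ , _ , 2∈ , 3∈′ , 2∈′ , 4∈ , <-trans 2<3 3<4 , 2<3) ∷ []) ∷ [] ∷ [])
    where
    1<3 : a₁ < a₃
    1<3 = <-trans 1<2 2<3
    3<5 : a₃ < a₅
    3<5 = <-trans 3<4 4<5
    in-H : ∀ {E} (p : E ∈ H′) → proj₁ (lift p) ∈ H
    in-H p = proj₁ (proj₂ (lift p))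
    ⊆ : ∀ {E} (p : E ∈ H′) {x} → x ∈ E → x ∈ proj₁ (lift p)
    ⊆ p = proj₂ (proj₂ (lift p))

free-⊆ : ∀ {H H′} → (∀ {E} → E ∈ H′ → E ∈ H) → Free H → Free H′
free-⊆ H′⊆H = free-transfer (λ {E} p → E , H′⊆H p , id) (λ _ _ n _ → n)

-- Edges may be empty, because the link of `v` contains the empty set whenever the singleton of `v`
-- is an edge. `V` is any list covering the vertices, and its length measures the size.
record Family (V : List ℕ) (H : Hypergraph) : Set where
  field
    distinct : Unique H
    sorted   : ∀ {E} → E ∈ H → Sorted E
    within   : ∀ {E x} → E ∈ H → x ∈ E → x ∈ V
    free     : Free H

without : ℕ → List ℕ → List ℕ
without v = filter (λ u → ¬? (u ≟ v))

∈-without⁺ : ∀ {v x xs} → x ∈ xs → x ≢ v → x ∈ without v xs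
∈-without⁺ {v} = ∈-filter⁺ (λ u → ¬? (u ≟ v))

∈-without⁻ : ∀ {v x xs} → x ∈ without v xs → x ∈ xs × x ≢ v
∈-without⁻ {v} = ∈-filter⁻ (λ u → ¬? (u ≟ v))

length-without : ∀ {v xs} → v ∈ xs → length (without v xs) < length xs
length-without {v} {xs} v∈ =
  filter-notAll (λ u → ¬? (u ≟ v)) xs (lose v∈ λ v≢v → v≢v refl)

star antistar : ℕ → Hypergraph → Hypergraph
star v = filter (v ∈?_)
antistar v = filter (λ E → ¬? (v ∈? E))

link : ℕ → Hypergraph → Hypergraph
link v H = map (without v) (star v H)

length-link : ∀ v H → length H ≡ length (link v H) + length (antistar v H)
length-link v H = trans (length-filter-split (v ∈?_) H)
  (cong (_+ length (antistar v H)) (sym (length-map (without v) (star v H))))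

module _ {V H} (fam : Family V H) where
  open Family fam

  antistar-family : ∀ v → Family (without v V) (antistar v H)
  antistar-family v = record
    { distinct = filter⁺ avoid? distinct
    ; sorted   = sorted ∘ proj₁ ∘ back
    ; within   = λ E∈ x∈ → let E∈H , v∉E = back E∈ in
        ∈-without⁺ (within E∈H x∈) λ { refl → v∉E x∈ }
    ; free     = free-⊆ (proj₁ ∘ back) free
    }
    where
    avoid? : Decidable₁ (v ∉_)
    avoid? E = ¬? (v ∈? E)
    back : ∀ {E} → E ∈ antistar v H → E ∈ H × v ∉ E
    back = ∈-filter⁻ avoid?

  -- All edges of the star contain `v`, so its removal merges no two of them, and a copy of `G₁` in
  -- the link lifts by putting `v` back. The list `N` is left open because in a clique family it is
  -- the graph neighbourhood of `v`.
  link-family : ∀ v N → (∀ {E x} → E ∈ H → v ∈ E → x ∈ E → x ≢ v → x ∈ N) →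
                Family N (link v H)
  link-family v N ⊆N = record
    { distinct = unique-map (without v) injective (filter⁺ (v ∈?_) distinct)
    ; sorted   = λ L∈ → let F , F∈ , L≡ = ∈-map⁻ (without v) L∈ in
        subst Sorted (sym L≡) (AllPairs.filter⁺ _ (sorted (proj₁ (back F∈))))
    ; within   = λ L∈ x∈ → let F , F∈ , L≡ = ∈-map⁻ (without v) L∈
                               F∈H , v∈F = back F∈
                               x∈F , x≢v = ∈-without⁻ (subst (_ ∈_) L≡ x∈)
                           in ⊆N F∈H v∈F x∈F x≢v
    ; free     = free-transfer lift
        (λ p p′ L≢L′ _ eq → L≢L′ (trans (lift-≡ p) (trans (cong (without v) eq) (sym (lift-≡ p′)))))
        free
    }
    where
    back : ∀ {E} → E ∈ star v H → E ∈ H × v ∈ E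
    back = ∈-filter⁻ (v ∈?_)

    same : ∀ {E E′} → v ∈ E′ → without v E ≡ without v E′ → ∀ {x} → x ∈ E → x ∈ E′
    same v∈E′ eq {x} x∈ with x ≟ v
    ... | yes refl = v∈E′
    ... | no x≢v = proj₁ (∈-without⁻ (subst (x ∈_) eq (∈-without⁺ x∈ x≢v)))

    injective : ∀ {E E′} → E ∈ star v H → E′ ∈ star v H → without v E ≡ without v E′ → E ≡ E′
    injective p p′ eq with E∈ , v∈E ← back p | E′∈ , v∈E′ ← back p′ =
      sorted-ext (sorted E∈) (sorted E′∈) (same v∈E′ eq) (same v∈E (sym eq))

    lift : ∀ {L} → L ∈ link v H → ∃[ F ] (F ∈ H × (∀ {x} → x ∈ L → x ∈ F))
    lift L∈ = let F , F∈ , L≡ = ∈-map⁻ (without v) L∈ in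
      F , proj₁ (back F∈) , λ x∈ → proj₁ (∈-without⁻ (subst (_ ∈_) L≡ x∈))

    lift-≡ : ∀ {L} (p : L ∈ link v H) → L ≡ without v (proj₁ (lift p))
    lift-≡ L∈ = proj₂ (proj₂ (∈-map⁻ (without v) L∈))

family-[] : ∀ {H} → Family [] H → length H ≤ 1
family-[] fam = unique-⊆⇒length-≤ {ys = [ [] ]} distinct λ E∈ → here (empty _ (within E∈))
  where
  open Family fam
  empty : ∀ E → (∀ {x} → x ∈ E → x ∈ []) → E ≡ []
  empty [] _ = refl
  empty (x ∷ E) E⊆[] with () ← E⊆[] (here refl)

family-widen : ∀ {V W H} → (∀ {x} → x ∈ V → x ∈ W) → Family V H → Family W H
family-widen V⊆W fam = record
  { distinct = distinct ; sorted = sorted ; within = λ E∈ x∈ → V⊆W (within E∈ x∈) ; free = free }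
  where open Family fam

family-sub : ∀ {V H H′} → Unique H′ → (∀ {E} → E ∈ H′ → E ∈ H) → Family V H → Family V H′
family-sub u sub fam = record
  { distinct = u ; sorted = sorted ∘ sub ; within = within ∘ sub ; free = free-⊆ sub free }
  where open Family fam

-- The count of all subsets, split by membership of `v`. It serves for the sizes below the threshold
-- of the recurrence.
family-≤-2^ : ∀ V {H} → Family V H → length H ≤ 2 ^ length V
family-≤-2^ [] fam = family-[] fam
family-≤-2^ (v ∷ V) {H} fam = begin
  length H                                     ≡⟨ length-link v H ⟩
  length (link v H) + length (antistar v H)    ≤⟨ +-mono-≤ (family-≤-2^ V link-fam) (family-≤-2^ V anti-fam) ⟩
  2 ^ length V + 2 ^ length V                  ≡⟨ cong (2 ^ length V +_) (sym (+-identityʳ _)) ⟩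
  2 ^ suc (length V)                           ∎
  where
  open ≤-Reasoning
  drop-v : ∀ {x} → x ∈ v ∷ V → x ≢ v → x ∈ V
  drop-v (here x≡v) x≢v = ⊥-elim (x≢v x≡v)
  drop-v (there x∈) _ = x∈
  link-fam : Family V (link v H)
  link-fam = link-family fam v V λ E∈ _ x∈ → drop-v (Family.within fam E∈ x∈)
  anti-fam : Family V (antistar v H)
  anti-fam = family-widen (λ x∈ → let x∈V , x≢v = ∈-without⁻ x∈ in drop-v x∈V x≢v)
               (antistar-family fam v)

-- Degeneracy and cliques of sparse graphs

Bound : ℕ → ℕ → Set
Bound n t = ∀ {V H} → length V ≤ n → Family V H → length H ≤ t

-- By `graph-size` a `G₁`-free graph on `n` vertices has at most this many edges per vertex, so
-- twice this number bounds its average degree.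
halfDegree : ℕ → ℕ
halfDegree n = 2 * (2 + ⌊log₂ n ⌋)

halfDegree-mono : ∀ {m n} → m ≤ n → halfDegree m ≤ halfDegree n
halfDegree-mono m≤n = *-monoʳ-≤ 2 (+-monoʳ-≤ 2 (⌊log₂⌋-mono-≤ m≤n))

IsEnd : ℕ → ℕ × ℕ → Set
IsEnd v (a , b) = v ≡ a ⊎ v ≡ b

isEnd? : ∀ v e → Dec (IsEnd v e)
isEnd? v (a , b) = (v ≟ a) ⊎-dec (v ≟ b)

degree : List (ℕ × ℕ) → ℕ → ℕ
degree G v = length (filter (isEnd? v) G)

-- Every pair has at most two ends in `S`, so the degrees sum to at most `2 * length G` and average
-- at most `2 * k`.
low-degree : ∀ {k S G} → Unique S → 0 < length S → length G ≤ length S * k →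
             ∃[ v ] (v ∈ S × degree G v ≤ 2 * k)
low-degree {k} {S} {G} u 0<S G≤ = sum-map-<⇒∃≤ (degree G) (2 * k) S (begin-strict
  sum (map (degree G) S)                                          ≡⟨ double-counting isEnd? S G ⟩
  sum (map (λ e → length (filter (λ v → isEnd? v e) S)) G)       ≤⟨ sum-map-≤ _ 2 G (λ {e} _ → two-ends e) ⟩
  2 * length G                                                   ≤⟨ *-monoʳ-≤ 2 G≤ ⟩
  2 * (length S * k)                                             ≡⟨ cong (2 *_) (*-comm (length S) k) ⟩
  2 * (k * length S)                                             ≡⟨ *-assoc 2 k (length S) ⟨
  -- The strict inequality required for averaging comes from `S` being nonempty.
  2 * k * length S                                               <⟨ m<n+m _ 0<S ⟩
  suc (2 * k) * length S                                         ∎)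
  where
  open ≤-Reasoning
  two-ends : ∀ e → length (filter (λ v → isEnd? v e) S) ≤ 2
  two-ends e@(a , b) = unique-⊆⇒length-≤ {ys = a ∷ b ∷ []} (filter⁺ _ u) λ x∈ →
    end∈ (proj₂ (∈-filter⁻ (λ v → isEnd? v e) {xs = S} x∈))
    where
    end∈ : ∀ {v} → IsEnd v e → v ∈ a ∷ b ∷ []
    end∈ (inj₁ eq) = here eq
    end∈ (inj₂ eq) = there (here eq)

otherEnd : ℕ → ℕ × ℕ → ℕ
otherEnd v (a , b) with v ≟ a
... | yes _ = b
... | no _ = a

Clique : List (ℕ × ℕ) → Edge → Set
Clique G E = ∀ {a b} → a ∈ E → b ∈ E → a < b → (a , b) ∈ G

clique-neighbour : ∀ {G E v x} → Clique G E → v ∈ E → x ∈ E → x ≢ v →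
                   x ∈ map (otherEnd v) (filter (isEnd? v) G)
clique-neighbour {G} {E} {v} {x} cl v∈ x∈ x≢v with <-cmp v x
... | tri≈ _ v≡x _ = ⊥-elim (x≢v (sym v≡x))
... | tri< v<x _ _ = subst (_∈ _) other (∈-map⁺ (otherEnd v) (∈-filter⁺ (isEnd? v) (cl v∈ x∈ v<x) (inj₁ refl)))
  where
  other : otherEnd v (v , x) ≡ x
  other with v ≟ v
  ... | yes _ = refl
  ... | no v≢v = ⊥-elim (v≢v refl)
... | tri> _ _ x<v = subst (_∈ _) other (∈-map⁺ (otherEnd v) (∈-filter⁺ (isEnd? v) (cl x∈ v∈ x<v) (inj₂ refl)))
  where
  other : otherEnd v (x , v) ≡ x
  other with v ≟ x
  ... | yes v≡x = ⊥-elim (x≢v (sym v≡x))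
  ... | no _ = refl

-- Graph and hypergraph are kept together, since all of these conditions survive the deletion of a
-- vertex along with everything that contains it.
record CliqueFamily (S : List ℕ) (G : List (ℕ × ℕ)) (H : Hypergraph) : Set where
  field
    distinct-vertices : Unique S
    graph-on          : IsGraphOn S G
    distinct-pairs    : Unique G
    graph-free        : GraphFree G
    family            : Family S H
    cliques           : ∀ {E} → E ∈ H → Clique G E

avoiding : ℕ → List (ℕ × ℕ) → List (ℕ × ℕ)
avoiding v = filter (λ e → ¬? (isEnd? v e))

module _ {S G H} (cf : CliqueFamily S G H) where
  open CliqueFamily cf

  -- The other vertices of a clique through `v` are neighbours of `v`, so the link lives on at most
  -- `degree G v` vertices.
  clique-link : ∀ v → Family (map (otherEnd v) (filter (isEnd? v) G)) (link v H)
  clique-link v = link-family family v _ λ E∈ v∈E x∈ x≢v → clique-neighbour (cliques E∈) v∈E x∈ x≢v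

  clique-antistar : ∀ v → CliqueFamily (without v S) (avoiding v G) (antistar v H)
  clique-antistar v = record
    { distinct-vertices = filter⁺ _ distinct-vertices
    ; graph-on = λ e∈ → let e∈G , ¬end = back e∈
                            a∈ , b∈ , a<b = graph-on e∈G
                        in ∈-without⁺ a∈ (λ a≡v → ¬end (inj₁ (sym a≡v))) ,
                           ∈-without⁺ b∈ (λ b≡v → ¬end (inj₂ (sym b≡v))) , a<b
    ; distinct-pairs = filter⁺ not-end? distinct-pairs
    ; graph-free = λ p q r s e f g h →
        graph-free p q r s (proj₁ (back e)) (proj₁ (back f)) (proj₁ (back g)) (proj₁ (back h))
    ; family = antistar-family family v
    ; cliques = λ {E} E∈ a∈ b∈ a<b →
        let E∈H , v∉E = ∈-filter⁻ (λ E → ¬? (v ∈? E)) {xs = H} E∈ in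
        ∈-filter⁺ not-end? (cliques E∈H a∈ b∈ a<b)
          λ { (inj₁ refl) → v∉E a∈ ; (inj₂ refl) → v∉E b∈ }
    }
    where
    not-end? : ∀ e → Dec (¬ IsEnd v e)
    not-end? e = ¬? (isEnd? v e)
    back : ∀ {e} → e ∈ avoiding v G → e ∈ G × ¬ IsEnd v e
    back = ∈-filter⁻ not-end?

  clique-low-degree : 0 < length S → ∃[ v ] (v ∈ S × degree G v ≤ 2 * halfDegree (length S))
  clique-low-degree 0<S =
    low-degree {halfDegree (length S)} {G = G} distinct-vertices 0<S (graph-size S G graph-on graph-free distinct-pairs)

module _ {n t} (bound : Bound (2 * halfDegree n) t) where

  -- Removing a vertex of small degree splits off a link living on few vertices.
  cliques-bound : ∀ k {S G H} → length S ≤ k → length S ≤ n → CliqueFamily S G H →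
                  length H ≤ 1 + k * t
  cliques-bound k {[]} _ _ cf = ≤-trans (family-[] (CliqueFamily.family cf)) (s≤s z≤n)
  cliques-bound (suc k) {S@(_ ∷ _)} {G} {H} S≤ S≤n cf = step (clique-low-degree cf (s≤s z≤n))
    where
    open ≤-Reasoning
    step : ∃[ v ] (v ∈ S × degree G v ≤ 2 * halfDegree (length S)) → length H ≤ 1 + suc k * t
    step (v , v∈S , deg≤) = begin
      length H                                     ≡⟨ length-link v H ⟩
      length (link v H) + length (antistar v H)    ≤⟨ +-mono-≤ link≤ anti≤ ⟩
      t + (1 + k * t)                              ≡⟨ +-suc t (k * t) ⟩
      1 + suc k * t                                ∎
      where
      link≤ : length (link v H) ≤ t
      link≤ = bound
        (≤-trans (≤-reflexive (length-map (otherEnd v) (filter (isEnd? v) G)))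
                 (≤-trans deg≤ (*-monoʳ-≤ 2 (halfDegree-mono S≤n))))
        (clique-link cf v)
      shrink : length (without v S) < length S
      shrink = length-without v∈S
      anti≤ : length (antistar v H) ≤ 1 + k * t
      anti≤ = cliques-bound k (≤-pred (≤-trans shrink S≤)) (≤-trans (<⇒≤ shrink) S≤n)
                (clique-antistar cf v)

-- Counting edges

_∈ᵖ?_ : (e : ℕ × ℕ) (G : List (ℕ × ℕ)) → Dec (e ∈ G)
_∈ᵖ?_ = Member._∈?_ (≡-dec _≟_ _≟_)

unique-map⁻ : (f : A → B) {xs : List A} → Unique (map f xs) →
              ∀ {x y} → x ∈ xs → y ∈ xs → f x ≡ f y → x ≡ y
unique-map⁻ f _ (here refl) (here refl) _ = refl
unique-map⁻ f (x∉ ∷ _) (here refl) (there y∈) eq = ⊥-elim (All.lookup x∉ (∈-map⁺ f y∈) eq)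
unique-map⁻ f (x∉ ∷ _) (there x∈) (here refl) eq = ⊥-elim (All.lookup x∉ (∈-map⁺ f x∈) (sym eq))
unique-map⁻ f (_ ∷ u) (there x∈) (there y∈) eq = unique-map⁻ f u x∈ y∈ eq

-- Each pair keeps the edge from which it was taken as its label. Distinct pairs have distinct
-- labels, which turns a copy of `G₁` among the pairs into one in `H`.
record Selection (H : Hypergraph) : Set where
  field
    chosen          : List ((ℕ × ℕ) × Edge)
    rest            : Hypergraph
    distinct-pairs  : Unique (map proj₁ chosen)
    distinct-labels : Unique (map proj₂ chosen)
    pair∈label      : ∀ {a b E} → ((a , b) , E) ∈ chosen → E ∈ H × a ∈ E × b ∈ E × a < b
    distinct-rest   : Unique rest
    rest⊆           : ∀ {E} → E ∈ rest → E ∈ H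
    rest-cliques    : ∀ {E} → E ∈ rest → Clique (map proj₁ chosen) E
    total           : length H ≡ length chosen + length rest

FreshPair : List (ℕ × ℕ) → ℕ × ℕ → Set
FreshPair G e@(a , b) = a < b × e ∉ G

freshPair? : ∀ G e → Dec (FreshPair G e)
freshPair? G e@(a , b) = (a <? b) ×-dec ¬? (e ∈ᵖ? G)

-- Each edge in turn takes a pair not taken before; an edge without such a pair
-- is already a clique of taken pairs.
select : ∀ {H} → Unique H → Selection H
select [] = record
  { chosen = [] ; rest = [] ; distinct-pairs = [] ; distinct-labels = [] ; pair∈label = λ ()
  ; distinct-rest = [] ; rest⊆ = λ () ; rest-cliques = λ () ; total = refl }
select {E ∷ H} (E∉ ∷ u) = extend (any? (freshPair? G) (cartesianProduct E E))
  where
  open Selection (select u)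
  G : List (ℕ × ℕ)
  G = map proj₁ chosen
  extend : Dec (Any (FreshPair G) (cartesianProduct E E)) → Selection (E ∷ H)
  extend (yes fresh) = add (find fresh)
    where
    add : ∃[ e ] (e ∈ cartesianProduct E E × FreshPair G e) → Selection (E ∷ H)
    add (e , e∈ , a<b , e∉G) = record
      { chosen = (e , E) ∷ chosen
      ; rest = rest
      ; distinct-pairs = All.tabulate (λ { e′∈ refl → e∉G e′∈ }) ∷ distinct-pairs
      ; distinct-labels = All.tabulate (λ E′∈ E≡E′ → fresh-label E′∈ E≡E′) ∷ distinct-labels
      ; pair∈label = λ { (here refl) → let a∈ , b∈ = ∈-cartesianProduct⁻ E E e∈ in here refl , a∈ , b∈ , a<b
                       ; (there p) → let E′∈ , q = pair∈label p in there E′∈ , q }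
      ; distinct-rest = distinct-rest
      ; rest⊆ = there ∘ rest⊆
      ; rest-cliques = λ E∈ a∈ b∈ a<b → there (rest-cliques E∈ a∈ b∈ a<b)
      ; total = cong suc total
      }
      where
      fresh-label : ∀ {E′} → E′ ∈ map proj₂ chosen → E ≢ E′
      fresh-label E′∈ E≡E′ with _ , p , refl ← ∈-map⁻ proj₂ E′∈ =
        All.lookup E∉ (proj₁ (pair∈label p)) E≡E′
  extend (no ¬fresh) = record
    { chosen = chosen
    ; rest = E ∷ rest
    ; distinct-pairs = distinct-pairs
    ; distinct-labels = distinct-labels
    ; pair∈label = λ p → let E′∈ , q = pair∈label p in there E′∈ , q
    ; distinct-rest = All.tabulate (λ E′∈ → All.lookup E∉ (rest⊆ E′∈)) ∷ distinct-rest
    ; rest⊆ = λ { (here eq) → here eq ; (there p) → there (rest⊆ p) }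
    ; rest-cliques = λ { (here refl) a∈ b∈ a<b → decidable-stable (_ ∈ᵖ? G) λ e∉G →
                           ¬fresh (lose (∈-cartesianProduct⁺ a∈ b∈) (a<b , e∉G))
                       ; (there E∈) → rest-cliques E∈ }
    ; total = trans (cong suc total) (sym (+-suc (length chosen) (length rest)))
    }

module _ {H} (s : Selection H) where
  open Selection s

  private
    label : ∀ {e} → e ∈ map proj₁ chosen → ∃[ E ] ((e , E) ∈ chosen)
    label e∈ with (e , E) , p , refl ← ∈-map⁻ proj₁ e∈ = E , p

    label-≢ : ∀ {e e′} (p : e ∈ map proj₁ chosen) (p′ : e′ ∈ map proj₁ chosen) → e ≢ e′ →
              proj₁ (label p) ≢ proj₁ (label p′)
    label-≢ p p′ e≢e′ eq =
      e≢e′ (proj₁ (,-injective (unique-map⁻ proj₂ distinct-labels (proj₂ (label p)) (proj₂ (label p′)) eq)))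

  selection-graph-free : Free H → GraphFree (map proj₁ chosen)
  selection-graph-free free 1<2 2<3 3<4 4<5 p₁ p₂ p₃ p₄
    with E₁∈ , 1∈₁ , 3∈₁ , 1<3 ← pair∈label (proj₂ (label p₁))
       | E₂∈ , 1∈₂ , 5∈₂ , _ ← pair∈label (proj₂ (label p₂))
       | E₃∈ , 2∈₃ , 3∈₃ , _ ← pair∈label (proj₂ (label p₃))
       | E₄∈ , 2∈₄ , 4∈₄ , _ ← pair∈label (proj₂ (label p₄)) =
    free 1<2 2<3 3<4 4<5 E₁∈ E₂∈ E₃∈ E₄∈ 1∈₁ 3∈₁ 1∈₂ 5∈₂ 2∈₃ 3∈₃ 2∈₄ 4∈₄
      ((label-≢ p₁ p₂ (<⇒≢ (<-trans 3<4 4<5) ∘ proj₂ ∘ ,-injective) ∷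
        label-≢ p₁ p₃ (<⇒≢ 1<2 ∘ proj₁ ∘ ,-injective) ∷
        label-≢ p₁ p₄ (<⇒≢ 1<2 ∘ proj₁ ∘ ,-injective) ∷ []) ∷
       (label-≢ p₂ p₃ (<⇒≢ 1<2 ∘ proj₁ ∘ ,-injective) ∷
        label-≢ p₂ p₄ (<⇒≢ 1<2 ∘ proj₁ ∘ ,-injective) ∷ []) ∷
       (label-≢ p₃ p₄ (<⇒≢ 3<4 ∘ proj₂ ∘ ,-injective) ∷ []) ∷ [] ∷ [])

  selection-graph-on : ∀ {V} → (∀ {E x} → E ∈ H → x ∈ E → x ∈ V) → IsGraphOn V (map proj₁ chosen)
  selection-graph-on ⊆V p =
    let E∈ , a∈ , b∈ , a<b = pair∈label (proj₂ (label p)) in ⊆V E∈ a∈ , ⊆V E∈ b∈ , a<b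

-- With d = `halfDegree n` and T the extremal function, this is T(n) ≤ n d + 1 + n T(2 d): the first
-- term counts the edges that received a pair, the rest counts the cliques.
recurrence : ∀ n {t} → Bound (2 * halfDegree n) t → Bound n (n * halfDegree n + (1 + n * t))
recurrence n {t} bound {V} {H} V≤n fam = begin
  length H                                    ≡⟨ total ⟩
  length chosen + length rest                 ≡⟨ cong (_+ length rest) (length-map proj₁ chosen) ⟨
  length G + length rest                      ≤⟨ +-mono-≤ graph≤ (cliques-bound bound n U≤n U≤n cf) ⟩
  n * halfDegree n + (1 + n * t)              ∎
  where
  open ≤-Reasoning
  open Family fam
  s : Selection H
  s = select distinct
  open Selection s
  G : List (ℕ × ℕ)
  G = map proj₁ chosen
  -- Averaging degrees calls for a vertex list without repetitions, which `V` may fail to be.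
  U : List ℕ
  U = deduplicate _≟_ V
  uU : Unique U
  uU = Dedup.deduplicate-! _≟_ V
  U≤n : length U ≤ n
  U≤n = ≤-trans (unique-⊆⇒length-≤ uU (∈-deduplicate⁻ _≟_ V)) V≤n
  fam-U : Family U H
  fam-U = family-widen (∈-deduplicate⁺ _≟_) fam
  cf : CliqueFamily U G rest
  cf = record
    { distinct-vertices = uU
    ; graph-on = selection-graph-on s (Family.within fam-U)
    ; distinct-pairs = distinct-pairs
    ; graph-free = selection-graph-free s free
    ; family = family-sub distinct-rest rest⊆ fam-U
    ; cliques = rest-cliques
    }
  graph≤ : length G ≤ n * halfDegree n
  graph≤ = ≤-trans
    (graph-size U G (CliqueFamily.graph-on cf) (CliqueFamily.graph-free cf) distinct-pairs)
    (*-mono-≤ U≤n (halfDegree-mono U≤n))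

-- Solving the recurrence

2^⌊log₂⌋≤ : ∀ n → 1 ≤ n → 2 ^ ⌊log₂ n ⌋ ≤ n
2^⌊log₂⌋≤ = <-rec _ go
  where
  go : ∀ n → (∀ {m} → m < n → 1 ≤ m → 2 ^ ⌊log₂ m ⌋ ≤ m) → 1 ≤ n → 2 ^ ⌊log₂ n ⌋ ≤ n
  go 1 _ _ = s≤s z≤n
  go n@(suc (suc m)) rec _ = begin
    2 ^ ⌊log₂ n ⌋                    ≡⟨ cong (2 ^_) (m+[n∸m]≡n (⌊log₂⌋-mono-≤ {2} {n} (s≤s (s≤s z≤n)))) ⟨
    2 * 2 ^ (⌊log₂ n ⌋ ∸ 1)          ≡⟨ cong (λ k → 2 * 2 ^ k) (⌊log₂⌊n/2⌋⌋≡⌊log₂n⌋∸1 n) ⟨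
    2 * 2 ^ ⌊log₂ ⌊ n /2⌋ ⌋          ≤⟨ *-monoʳ-≤ 2 (rec (⌊n/2⌋<n (suc m)) (s≤s z≤n)) ⟩
    2 * ⌊ n /2⌋                      ≡⟨ cong (⌊ n /2⌋ +_) (+-identityʳ _) ⟩
    ⌊ n /2⌋ + ⌊ n /2⌋                ≤⟨ +-monoʳ-≤ ⌊ n /2⌋ (⌊n/2⌋≤⌈n/2⌉ n) ⟩
    ⌊ n /2⌋ + ⌈ n /2⌉                ≡⟨ ⌊n/2⌋+⌈n/2⌉≡n n ⟩
    n                                ∎
    where open ≤-Reasoning

square : ℕ → ℕ
square x = x * x

square-mono : ∀ {x y} → x ≤ y → square x ≤ square y
square-mono x≤y = *-mono-≤ x≤y x≤y

-- For k = ⌊log₂ m⌋ and d = `halfDegree m` this is d + (1 + 2 d)², which must not exceed `m` for the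
-- quadratic bound to reproduce itself.
cost : ℕ → ℕ
cost k = 2 * (2 + k) + square (1 + 2 * (2 * (2 + k)))

cost≤2^ : ∀ j → cost (12 + j) ≤ 2 ^ (12 + j)
-- At 12 the inequality reads 3277 ≤ 4096, whereas at 11 it fails; hence the shift.
cost≤2^ zero = ≤ᵇ⇒≤ (cost 12) (2 ^ 12) _
cost≤2^ (suc j) = begin
  cost (13 + j)                                        ≤⟨ m≤m+n _ _ ⟩
  -- The summand is the difference of `2 * cost (12 + j)` and `cost (13 + j)`: the cost at most
  -- doubles while the power doubles.
  cost (13 + j) + (16 * (j * j) + (426 * j + 2803))    ≡⟨ doubling ⟩
  2 * cost (12 + j)                                    ≤⟨ *-monoʳ-≤ 2 (cost≤2^ j) ⟩
  2 ^ (13 + j)                                         ∎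
  where
  open ≤-Reasoning
  doubling : cost (13 + j) + (16 * (j * j) + (426 * j + 2803)) ≡ 2 * cost (12 + j)
  doubling = solve 1 (λ j →
      (con 2 :* (con 15 :+ j) :+ (con 1 :+ con 2 :* (con 2 :* (con 15 :+ j))) :* (con 1 :+ con 2 :* (con 2 :* (con 15 :+ j))))
      :+ (con 16 :* (j :* j) :+ (con 426 :* j :+ con 2803))
      := con 2 :* (con 2 :* (con 14 :+ j) :+ (con 1 :+ con 2 :* (con 2 :* (con 14 :+ j))) :* (con 1 :+ con 2 :* (con 2 :* (con 14 :+ j)))))
    refl j
    where open +-*-Solver

2^≤⇒≤log₂ : ∀ k {m} → 2 ^ k ≤ m → k ≤ ⌊log₂ m ⌋
2^≤⇒≤log₂ k 2^k≤m = ≤-trans (≤-reflexive (sym (⌊log₂[2^n]⌋≡n k))) (⌊log₂⌋-mono-≤ 2^k≤m)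

cost-log≤ : ∀ m → 2 ^ 12 ≤ m → cost ⌊log₂ m ⌋ ≤ m
cost-log≤ m large = begin
  cost ⌊log₂ m ⌋     ≡⟨ cong cost k≡ ⟨
  cost (12 + j)      ≤⟨ cost≤2^ j ⟩
  2 ^ (12 + j)       ≡⟨ cong (2 ^_) k≡ ⟩
  2 ^ ⌊log₂ m ⌋      ≤⟨ 2^⌊log₂⌋≤ m (≤-trans (s≤s z≤n) large) ⟩
  m                  ∎
  where
  open ≤-Reasoning
  j : ℕ
  j = ⌊log₂ m ⌋ ∸ 12
  k≡ : 12 + j ≡ ⌊log₂ m ⌋
  k≡ = m+[n∸m]≡n (2^≤⇒≤log₂ 12 large)

module _ (m₀ : ℕ) (cost≤ : ∀ m → m₀ ≤ m → cost ⌊log₂ m ⌋ ≤ m) where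

  private
    C : ℕ
    C = 2 ^ m₀

    Quadratic : ℕ → Set
    Quadratic m = Bound m (C * square (1 + m))

    1≤C : 1 ≤ C
    1≤C = >-nonZero⁻¹ C where instance _ = m^n≢0 2 m₀

  -- Strong induction. Below `m₀` there are at most `C` subsets. From `m₀` on, the recurrence calls
  -- for the bound C (1 + 2 d)² at 2 d, and d + (1 + 2 d)² ≤ m keeps the total within C (m² + 1).
  quadratic-bound : ∀ m → Quadratic m
  quadratic-bound = <-rec _ go
    where
    go : ∀ m → (∀ {l} → l < m → Quadratic l) → Quadratic m
    go m rec {V} {H} V≤m fam with m₀ ≤? m
    ... | no m₀≰m = begin
      length H              ≤⟨ family-≤-2^ V fam ⟩
      2 ^ length V          ≤⟨ ^-monoʳ-≤ 2 (≤-trans V≤m (<⇒≤ (≰⇒> m₀≰m))) ⟩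
      C                     ≤⟨ m≤m*n C (square (1 + m)) ⟩
      C * square (1 + m)    ∎
      where open ≤-Reasoning
    ... | yes m₀≤m = begin
      length H                                ≤⟨ recurrence m (rec smaller) V≤m fam ⟩
      m * d + (1 + m * (C * q))               ≤⟨ +-mono-≤ (m≤n*m (m * d) C) (+-monoˡ-≤ _ 1≤C) ⟩
      C * (m * d) + (C + m * (C * q))         ≡⟨ solve 4 (λ C m d q →
           C :* (m :* d) :+ (C :+ m :* (C :* q)) := C :* (m :* (d :+ q) :+ con 1)) refl C m d q ⟩
      C * (m * (d + q) + 1)                   ≤⟨ *-monoʳ-≤ C (+-monoˡ-≤ 1 (*-monoʳ-≤ m d+q≤m)) ⟩
      C * (m * m + 1)                         ≤⟨ *-monoʳ-≤ C (m≤m+n _ (2 * m)) ⟩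
      C * (m * m + 1 + 2 * m)                 ≡⟨ solve 2 (λ C m →
           C :* (m :* m :+ con 1 :+ con 2 :* m) := C :* ((con 1 :+ m) :* (con 1 :+ m))) refl C m ⟩
      C * square (1 + m)                      ∎
      where
      open ≤-Reasoning
      open +-*-Solver
      instance _ = >-nonZero 1≤C
      d q : ℕ
      d = halfDegree m
      q = square (1 + 2 * d)
      d+q≤m : d + q ≤ m
      d+q≤m = cost≤ m m₀≤m
      smaller : 2 * d < m
      smaller = ≤-trans (m≤m*n (1 + 2 * d) (1 + 2 * d)) (≤-trans (m≤n+m q d) d+q≤m)

  -- One more use of the recurrence, now with the quadratic bound at 2 d. As k = ⌊log₂ n⌋ is at
  -- least 1, d ≤ 6 k and 1 + 2 d ≤ 13 k; so 169 is 13², and 7 consists of 6 for the graph and 1 for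
  -- the additive unit.
  edge-bound : ∀ n → 2 ≤ n → Bound n ((7 + 169 * C) * (n * square ⌊log₂ n ⌋))
  edge-bound n 2≤n {V} {H} V≤n fam = begin
    length H                                          ≤⟨ recurrence n (quadratic-bound (2 * halfDegree n)) V≤n fam ⟩
    n * d + (1 + n * (C * square (1 + 2 * d)))        ≤⟨ +-mono-≤ (*-monoʳ-≤ n d≤) (+-mono-≤ 1≤ (*-monoʳ-≤ n (*-monoʳ-≤ C (square-mono 1+2d≤)))) ⟩
    n * (6 * (k * k)) + (n * (k * k) + n * (C * square (13 * k)))
      ≡⟨ solve 3 (λ n k C → n :* (con 6 :* (k :* k)) :+ (n :* (k :* k) :+ n :* (C :* ((con 13 :* k) :* (con 13 :* k))))
           := (con 7 :+ con 169 :* C) :* (n :* (k :* k))) refl n k C ⟩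
    (7 + 169 * C) * (n * square k)                    ∎
    where
    open ≤-Reasoning
    open +-*-Solver
    d k : ℕ
    d = halfDegree n
    k = ⌊log₂ n ⌋
    1≤k : 1 ≤ k
    1≤k = ⌊log₂⌋-mono-≤ 2≤n
    instance _ = >-nonZero 1≤k
    k≤kk : k ≤ k * k
    k≤kk = m≤m*n k k
    4≤4k : 4 ≤ 4 * k
    4≤4k = *-monoʳ-≤ 4 1≤k
    d≤6k : d ≤ 6 * k
    d≤6k = begin
      2 * (2 + k)      ≡⟨ solve 1 (λ k → con 2 :* (con 2 :+ k) := con 4 :+ con 2 :* k) refl k ⟩
      4 + 2 * k        ≤⟨ +-monoˡ-≤ (2 * k) 4≤4k ⟩
      4 * k + 2 * k    ≡⟨ solve 1 (λ k → con 4 :* k :+ con 2 :* k := con 6 :* k) refl k ⟩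
      6 * k            ∎
    d≤ : d ≤ 6 * (k * k)
    d≤ = ≤-trans d≤6k (*-monoʳ-≤ 6 k≤kk)
    1+2d≤ : 1 + 2 * d ≤ 13 * k
    1+2d≤ = begin
      1 + 2 * d          ≤⟨ +-mono-≤ 1≤k (*-monoʳ-≤ 2 d≤6k) ⟩
      k + 2 * (6 * k)    ≡⟨ solve 1 (λ k → k :+ con 2 :* (con 6 :* k) := con 13 :* k) refl k ⟩
      13 * k             ∎
    1≤ : 1 ≤ n * (k * k)
    1≤ = *-mono-≤ (≤-trans (s≤s z≤n) 2≤n) (≤-trans 1≤k k≤kk)

  quasilinear-bound : ∃[ D ] (∀ n → 2 ≤ n → Bound n (D * (n * square ⌊log₂ n ⌋)))
  quasilinear-bound = 7 + 169 * C , edge-bound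

abstract
  -- Abstract, so that the constant built from 2 ^ 2 ^ 12 is never evaluated.
  edges-quasilinear : ∃[ D ] (∀ n → 2 ≤ n → Bound n (D * (n * square ⌊log₂ n ⌋)))
  edges-quasilinear = quasilinear-bound (2 ^ 12) cost-log≤

-- Counting incidences

-- Five is the number of vertices of `G₁`. A remainder of at most four vertices is dropped.
blocks : Edge → List Edge
blocks (a ∷ b ∷ c ∷ d ∷ e ∷ E) = (a ∷ b ∷ c ∷ d ∷ e ∷ []) ∷ blocks E
blocks _ = []

length-blocks : ∀ E → length E ≤ 5 * length (blocks E) + 4
length-blocks [] = z≤n
length-blocks (_ ∷ []) = s≤s z≤n
length-blocks (_ ∷ _ ∷ []) = s≤s (s≤s z≤n)
length-blocks (_ ∷ _ ∷ _ ∷ []) = s≤s (s≤s (s≤s z≤n))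
length-blocks (_ ∷ _ ∷ _ ∷ _ ∷ []) = s≤s (s≤s (s≤s (s≤s z≤n)))
length-blocks (_ ∷ _ ∷ _ ∷ _ ∷ _ ∷ E) =
  ≤-trans (+-monoʳ-≤ 5 (length-blocks E))
          (≤-reflexive (cong (_+ 4) (sym (*-suc 5 (length (blocks E))))))

blocks-⊆ : ∀ E {P x} → P ∈ blocks E → x ∈ P → x ∈ E
blocks-⊆ (a ∷ b ∷ c ∷ d ∷ e ∷ E) (here refl) x∈ = ∈-++⁺ˡ {xs = a ∷ b ∷ c ∷ d ∷ e ∷ []} x∈
blocks-⊆ (a ∷ b ∷ c ∷ d ∷ e ∷ E) (there P∈) x∈ =
  ∈-++⁺ʳ (a ∷ b ∷ c ∷ d ∷ e ∷ []) (blocks-⊆ E P∈ x∈)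

Separated : Edge → Edge → Set
Separated P Q = ∀ {x y} → x ∈ P → y ∈ Q → x < y

sorted-++ : ∀ xs {ys} → Sorted (xs ++ ys) → Sorted xs × Sorted ys × Separated xs ys
sorted-++ [] s = [] , s , λ ()
sorted-++ (x ∷ xs) {ys} (x< ∷ s) with sxs , sys , sep ← sorted-++ xs s =
  All.tabulate (λ y∈ → All.lookup x< (∈-++⁺ˡ y∈)) ∷ sxs , sys ,
  λ { (here refl) y∈ → All.lookup x< (∈-++⁺ʳ xs y∈) ; (there x∈) y∈ → sep x∈ y∈ }

blocks-sorted : ∀ E → Sorted E → ∀ {P} → P ∈ blocks E → Sorted P
blocks-sorted (a ∷ b ∷ c ∷ d ∷ e ∷ E) s (here refl) = proj₁ (sorted-++ (a ∷ b ∷ c ∷ d ∷ e ∷ []) s)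
blocks-sorted (a ∷ b ∷ c ∷ d ∷ e ∷ E) s (there P∈) =
  blocks-sorted E (proj₁ (proj₂ (sorted-++ (a ∷ b ∷ c ∷ d ∷ e ∷ []) s))) P∈

blocks-separated : ∀ E → Sorted E → AllPairs Separated (blocks E)
blocks-separated [] _ = []
blocks-separated (_ ∷ []) _ = []
blocks-separated (_ ∷ _ ∷ []) _ = []
blocks-separated (_ ∷ _ ∷ _ ∷ []) _ = []
blocks-separated (_ ∷ _ ∷ _ ∷ _ ∷ []) _ = []
blocks-separated (a ∷ b ∷ c ∷ d ∷ e ∷ E) s
  with _ , sE , sep ← sorted-++ (a ∷ b ∷ c ∷ d ∷ e ∷ []) s =
  All.tabulate (λ Q∈ x∈ y∈ → sep x∈ (blocks-⊆ E Q∈ y∈)) ∷ blocks-separated E sE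

block-shape : ∀ E {P} → P ∈ blocks E → ∃[ a ] ∃[ b ] ∃[ c ] ∃[ d ] ∃[ e ] P ≡ a ∷ b ∷ c ∷ d ∷ e ∷ []
block-shape (a ∷ b ∷ c ∷ d ∷ e ∷ E) (here refl) = a , b , c , d , e , refl
block-shape (a ∷ b ∷ c ∷ d ∷ e ∷ E) (there P∈) = block-shape E P∈

-- A nonempty set is not separated from itself, and every block has five elements.
blocks-unique : ∀ E → Sorted E → Unique (blocks E)
blocks-unique E s = go (blocks-separated E s) (block-shape E)
  where
  go : ∀ {Ps} → AllPairs Separated Ps →
       (∀ {P} → P ∈ Ps → ∃[ a ] ∃[ b ] ∃[ c ] ∃[ d ] ∃[ e ] P ≡ a ∷ b ∷ c ∷ d ∷ e ∷ []) → Unique Ps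
  go [] _ = []
  go (sep ∷ seps) shape with _ , _ , _ , _ , _ , refl ← shape (here refl) =
    All.map (λ { sepP refl → <-irrefl refl (sepP (here refl) (here refl)) }) sep ∷ go seps (shape ∘ there)

blocks-interleaved : ∀ E → Sorted E → ∀ {P Q} → P ∈ blocks E → Q ∈ blocks E → Interleaved P Q → P ≡ Q
blocks-interleaved E s P∈ Q∈ (x , y , x′ , y′ , x∈ , y∈ , x′∈ , y′∈ , x<y′ , x′<y) =
  go (blocks-separated E s) P∈ Q∈ x∈ y∈ x′∈ y′∈
  where
  go : ∀ {Ps P Q} → AllPairs Separated Ps → P ∈ Ps → Q ∈ Ps →
       x ∈ P → y ∈ P → x′ ∈ Q → y′ ∈ Q → P ≡ Q
  go _ (here refl) (here refl) _ _ _ _ = refl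
  go (sep ∷ _) (here refl) (there Q∈) _ y∈ x′∈ _ = ⊥-elim (<-asym x′<y (All.lookup sep Q∈ y∈ x′∈))
  go (sep ∷ _) (there P∈) (here refl) x∈ _ _ y′∈ = ⊥-elim (<-asym x<y′ (All.lookup sep P∈ y′∈ x∈))
  go (_ ∷ seps) (there P∈) (there Q∈) = go seps P∈ Q∈

_≟ᴱ_ : (E E′ : Edge) → Dec (E ≡ E′)
_≟ᴱ_ = List.≡-dec _≟_

inBlocks? : ∀ E P → Dec (P ∈ blocks E)
inBlocks? E P = Member._∈?_ _≟ᴱ_ P (blocks E)

inc-≤-blocks : ∀ H → inc H ≤ 5 * sum (map (λ E → length (blocks E)) H) + 4 * length H
inc-≤-blocks [] = z≤n
inc-≤-blocks (E ∷ H) = ≤-trans (+-mono-≤ (length-blocks E) (inc-≤-blocks H))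
  (≤-reflexive (solve 3 (λ b s l → con 5 :* b :+ con 4 :+ (con 5 :* s :+ con 4 :* l)
     := con 5 :* (b :+ s) :+ con 4 :* (con 1 :+ l)) refl (length (blocks E)) _ (length H)))
  where open +-*-Solver

sum-map-mono : (f g : A → ℕ) (xs : List A) → (∀ {x} → x ∈ xs → f x ≤ g x) → sum (map f xs) ≤ sum (map g xs)
sum-map-mono f g [] _ = z≤n
sum-map-mono f g (x ∷ xs) f≤g = +-mono-≤ (f≤g (here refl)) (sum-map-mono f g xs (f≤g ∘ there))

module _ {V H} (fam : Family V H) where
  open Family fam

  private
    -- A block may occur in several edges; repetitions are removed here and accounted for by
    -- `hosts≤3`.
    allBlocks : Hypergraph
    allBlocks = deduplicate _≟ᴱ_ (concatMap blocks H)

    source : ∀ {P} → P ∈ allBlocks → ∃[ E ] (E ∈ H × P ∈ blocks E)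
    source P∈ = find (∈-concatMap⁻ blocks {xs = H} (∈-deduplicate⁻ _≟ᴱ_ (concatMap blocks H) P∈))

    allBlocks⁺ : ∀ {E P} → E ∈ H → P ∈ blocks E → P ∈ allBlocks
    allBlocks⁺ E∈ P∈ = ∈-deduplicate⁺ _≟ᴱ_ (∈-concatMap⁺ blocks (lose E∈ P∈))

    lift : ∀ {P} → P ∈ allBlocks → ∃[ E ] (E ∈ H × (∀ {x} → x ∈ P → x ∈ E))
    lift P∈ = let E , E∈ , P∈E = source P∈ in E , E∈ , blocks-⊆ E P∈E

  -- Blocks of the same edge are separated, so they cannot both occur in a copy of G₁.
  blocks-family : Family V allBlocks
  blocks-family = record
    { distinct = Dedup.deduplicate-! _≟ᴱ_ _
    ; sorted = λ P∈ → let E , E∈ , P∈E = source P∈ in blocks-sorted E (sorted E∈) P∈E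
    ; within = λ P∈ x∈ → let E , E∈ , ⊆E = lift P∈ in within E∈ (⊆E x∈)
    ; free = free-transfer lift
        (λ p q P≢Q il eq → let E , E∈ , P∈E = source p ; _ , _ , Q∈E′ = source q in
          P≢Q (blocks-interleaved E (sorted E∈) P∈E (subst (λ F → _ ∈ blocks F) (sym eq) Q∈E′) il))
        free
    }

  private
    hosts : Edge → Hypergraph
    hosts P = filter (λ E → inBlocks? E P) H

    -- Four distinct edges sharing the five vertices of a block would contain `G₁`, each serving as
    -- one of its edges.
    hosts≤3 : ∀ {P} → P ∈ allBlocks → length (hosts P) ≤ 3
    hosts≤3 {P} P∈ = go (hosts P) (filter⁺ _ distinct) (∈-filter⁻ (λ E → inBlocks? E P))
      where
      go : ∀ F → Unique F → (∀ {E} → E ∈ F → E ∈ H × P ∈ blocks E) → length F ≤ 3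
      go [] _ _ = z≤n
      go (_ ∷ []) _ _ = s≤s z≤n
      go (_ ∷ _ ∷ []) _ _ = s≤s (s≤s z≤n)
      go (_ ∷ _ ∷ _ ∷ []) _ _ = s≤s (s≤s (s≤s z≤n))
      go (E₁ ∷ E₂ ∷ E₃ ∷ E₄ ∷ F) ((n₁₂ ∷ n₁₃ ∷ n₁₄ ∷ _) ∷ (n₂₃ ∷ n₂₄ ∷ _) ∷ (n₃₄ ∷ _) ∷ _) back
        with E₁∈ , P∈₁ ← back (here refl)
           | E₂∈ , P∈₂ ← back (there (here refl))
           | E₃∈ , P∈₃ ← back (there (there (here refl)))
           | E₄∈ , P∈₄ ← back (there (there (there (here refl))))
        with a , b , c , d , e , refl ← block-shape E₁ P∈₁
        with (a<b ∷ _) ∷ (b<c ∷ _) ∷ (c<d ∷ _) ∷ (d<e ∷ _) ∷ _ ← blocks-sorted E₁ (sorted E₁∈) P∈₁ =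
        ⊥-elim (free a<b b<c c<d d<e E₁∈ E₂∈ E₃∈ E₄∈
          (blocks-⊆ E₁ P∈₁ (here refl)) (blocks-⊆ E₁ P∈₁ (there (there (here refl))))
          (blocks-⊆ E₂ P∈₂ (here refl)) (blocks-⊆ E₂ P∈₂ (there (there (there (there (here refl))))))
          (blocks-⊆ E₃ P∈₃ (there (here refl))) (blocks-⊆ E₃ P∈₃ (there (there (here refl))))
          (blocks-⊆ E₄ P∈₄ (there (here refl))) (blocks-⊆ E₄ P∈₄ (there (there (there (here refl)))))
          ((n₁₂ ∷ n₁₃ ∷ n₁₄ ∷ []) ∷ (n₂₃ ∷ n₂₄ ∷ []) ∷ (n₃₄ ∷ []) ∷ [] ∷ []))

    block-count : sum (map (λ E → length (blocks E)) H) ≤ 3 * length allBlocks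
    block-count = begin
      sum (map (λ E → length (blocks E)) H)                                    ≤⟨ sum-map-mono _ _ H each ⟩
      sum (map (λ E → length (filter (inBlocks? E) allBlocks)) H)             ≡⟨ double-counting inBlocks? H allBlocks ⟩
      sum (map (λ P → length (hosts P)) allBlocks)                            ≤⟨ sum-map-≤ _ 3 allBlocks hosts≤3 ⟩
      3 * length allBlocks                                                     ∎
      where
      open ≤-Reasoning
      each : ∀ {E} → E ∈ H → length (blocks E) ≤ length (filter (inBlocks? E) allBlocks)
      each {E} E∈ = unique-⊆⇒length-≤ (blocks-unique E (sorted E∈))
        λ P∈ → ∈-filter⁺ (inBlocks? E) (allBlocks⁺ E∈ P∈) P∈

  inc-bound : ∀ {n t} → length V ≤ n → Bound n t → inc H ≤ 19 * t
  inc-bound {n} {t} V≤n bound = begin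
    inc H                                                                  ≤⟨ inc-≤-blocks H ⟩
    -- Each block gives five incidences in at most three edges, and each edge has at most four
    -- vertices left over: 19 = 5 * 3 + 4.
    5 * sum (map (λ E → length (blocks E)) H) + 4 * length H              ≤⟨ +-mono-≤ (*-monoʳ-≤ 5 (≤-trans block-count (*-monoʳ-≤ 3 (bound V≤n blocks-family)))) (*-monoʳ-≤ 4 (bound V≤n fam)) ⟩
    5 * (3 * t) + 4 * t                                                    ≡⟨ solve 1 (λ t → con 5 :* (con 3 :* t) :+ con 4 :* t := con 19 :* t) refl t ⟩
    19 * t                                                                 ∎
    where
    open ≤-Reasoning
    open +-*-Solver

-- From explicit copies of `G₁` to containment of hypergraphs

pattern-embedding : ∀ {H a₁ a₂ a₃ a₄ a₅ E₁ E₂ E₃ E₄} → a₁ < a₂ → a₂ < a₃ → a₃ < a₄ → a₄ < a₅ →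
  E₁ ∈ H → E₂ ∈ H → E₃ ∈ H → E₄ ∈ H →
  a₁ ∈ E₁ → a₃ ∈ E₁ → a₁ ∈ E₂ → a₅ ∈ E₂ → a₂ ∈ E₃ → a₃ ∈ E₃ → a₂ ∈ E₄ → a₄ ∈ E₄ →
  Unique (E₁ ∷ E₂ ∷ E₃ ∷ E₄ ∷ []) → H ≻ G₁
pattern-embedding {H} {a₁} {a₂} {a₃} {a₄} {a₅} 1<2 2<3 3<4 4<5 E₁∈ E₂∈ E₃∈ E₄∈
  1∈₁ 3∈₁ 1∈₂ 5∈₂ 2∈₃ 3∈₃ 2∈₄ 4∈₄ ((n₁₂ ∷ n₁₃ ∷ n₁₄ ∷ []) ∷ (n₂₃ ∷ n₂₄ ∷ []) ∷ (n₃₄ ∷ []) ∷ _) =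
  φ , f , (λ u v u∈ v∈ u<v → φ-mono (proj₁ (range u∈)) u<v (proj₂ (range v∈))) ,
  φ-in-H , (λ {i} {j} → f-injective i j) , contains
  where
  φ : ℕ → ℕ
  φ 1 = a₁
  φ 2 = a₂
  φ 3 = a₃
  φ 4 = a₄
  φ 5 = a₅
  -- The vertices of `G₁` are 1 to 5, so the value here is arbitrary.
  φ _ = 0

  -- An edge is addressed by its position in the membership proof; different edges have different
  -- positions.
  f : Fin 4 → Fin (length H)
  f fzero = Any.index E₁∈
  f (fsuc fzero) = Any.index E₂∈
  f (fsuc (fsuc fzero)) = Any.index E₃∈
  f (fsuc (fsuc (fsuc fzero))) = Any.index E₄∈

  range : ∀ {u} → u ∈V G₁ → 1 ≤ u × u ≤ 5
  range = All.lookup (from-yes (All.all? (λ u → (1 ≤? u) ×-dec (u ≤? 5)) (concat G₁)))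

  φ-step : ∀ u → 1 ≤ u → suc u ≤ 5 → φ u < φ (suc u)
  φ-step 1 _ _ = 1<2
  φ-step 2 _ _ = 2<3
  φ-step 3 _ _ = 3<4
  φ-step 4 _ _ = 4<5
  φ-step (suc (suc (suc (suc (suc _))))) _ (s≤s (s≤s (s≤s (s≤s (s≤s ())))))

  φ-mono : ∀ {u v} → 1 ≤ u → u < v → v ≤ 5 → φ u < φ v
  φ-mono {u} {suc v} 1≤u u<1+v v≤5 with m≤n⇒m<n∨m≡n (≤-pred u<1+v)
  ... | inj₂ refl = φ-step u 1≤u v≤5
  ... | inj₁ u<v = <-trans (φ-mono 1≤u u<v (<⇒≤ v≤5)) (φ-step v (≤-trans 1≤u (<⇒≤ u<v)) v≤5)

  index-≢ : ∀ {E E′} (p : E ∈ H) (q : E′ ∈ H) → E ≢ E′ → Any.index p ≢ Any.index q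
  index-≢ p q E≢E′ eq = E≢E′ (trans (lookup-index p) (trans (cong (lookup H) eq) (sym (lookup-index q))))

  f-injective : ∀ i j → f i ≡ f j → i ≡ j
  f-injective fzero fzero _ = refl
  f-injective fzero (fsuc fzero) eq = ⊥-elim (index-≢ E₁∈ E₂∈ n₁₂ eq)
  f-injective fzero (fsuc (fsuc fzero)) eq = ⊥-elim (index-≢ E₁∈ E₃∈ n₁₃ eq)
  f-injective fzero (fsuc (fsuc (fsuc fzero))) eq = ⊥-elim (index-≢ E₁∈ E₄∈ n₁₄ eq)
  f-injective (fsuc fzero) fzero eq = ⊥-elim (index-≢ E₁∈ E₂∈ n₁₂ (sym eq))
  f-injective (fsuc fzero) (fsuc fzero) _ = refl
  f-injective (fsuc fzero) (fsuc (fsuc fzero)) eq = ⊥-elim (index-≢ E₂∈ E₃∈ n₂₃ eq)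
  f-injective (fsuc fzero) (fsuc (fsuc (fsuc fzero))) eq = ⊥-elim (index-≢ E₂∈ E₄∈ n₂₄ eq)
  f-injective (fsuc (fsuc fzero)) fzero eq = ⊥-elim (index-≢ E₁∈ E₃∈ n₁₃ (sym eq))
  f-injective (fsuc (fsuc fzero)) (fsuc fzero) eq = ⊥-elim (index-≢ E₂∈ E₃∈ n₂₃ (sym eq))
  f-injective (fsuc (fsuc fzero)) (fsuc (fsuc fzero)) _ = refl
  f-injective (fsuc (fsuc fzero)) (fsuc (fsuc (fsuc fzero))) eq = ⊥-elim (index-≢ E₃∈ E₄∈ n₃₄ eq)
  f-injective (fsuc (fsuc (fsuc fzero))) fzero eq = ⊥-elim (index-≢ E₁∈ E₄∈ n₁₄ (sym eq))
  f-injective (fsuc (fsuc (fsuc fzero))) (fsuc fzero) eq = ⊥-elim (index-≢ E₂∈ E₄∈ n₂₄ (sym eq))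
  f-injective (fsuc (fsuc (fsuc fzero))) (fsuc (fsuc fzero)) eq = ⊥-elim (index-≢ E₃∈ E₄∈ n₃₄ (sym eq))
  f-injective (fsuc (fsuc (fsuc fzero))) (fsuc (fsuc (fsuc fzero))) _ = refl

  at : ∀ {E x} (p : E ∈ H) → x ∈ E → x ∈ lookup H (Any.index p)
  at p = subst (_ ∈_) (lookup-index p)

  contains : ∀ i v → v ∈ lookup G₁ i → φ v ∈ lookup H (f i)
  contains fzero _ (here refl) = at E₁∈ 1∈₁
  contains fzero _ (there (here refl)) = at E₁∈ 3∈₁
  contains (fsuc fzero) _ (here refl) = at E₂∈ 1∈₂
  contains (fsuc fzero) _ (there (here refl)) = at E₂∈ 5∈₂
  contains (fsuc (fsuc fzero)) _ (here refl) = at E₃∈ 2∈₃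
  contains (fsuc (fsuc fzero)) _ (there (here refl)) = at E₃∈ 3∈₃
  contains (fsuc (fsuc (fsuc fzero))) _ (here refl) = at E₄∈ 2∈₄
  contains (fsuc (fsuc (fsuc fzero))) _ (there (here refl)) = at E₄∈ 4∈₄

  φ-in-H : ∀ u → u ∈V G₁ → φ u ∈V H
  φ-in-H u u∈ = let E , u∈E , E∈ = ∈-concat⁻′ G₁ u∈ in
    ∈-concat⁺′ (contains (Any.index E∈) u (subst (u ∈_) (lookup-index E∈) u∈E)) (∈-lookup {xs = H} (f (Any.index E∈)))

-- The vertex list is the one whose length defines `vtx`, so the bound on `vtx H` carries over as it
-- stands.
admissible-family : ∀ {n H} → Admissible G₁ n H →
                    ∃[ V ] (length V ≤ n × Family V H)
admissible-family {n} {H} (wf , simple , vtx≤n , ¬≻) = deduplicate _≟_ (concat H) , vtx≤n , record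
  { distinct = simple
  ; sorted = λ E∈ → Linked⇒AllPairs <-trans (proj₂ (All.lookup wf E∈))
  ; within = λ E∈ x∈ → ∈-deduplicate⁺ _≟_ (∈-concat⁺′ x∈ E∈)
  ; free = λ 1<2 2<3 3<4 4<5 E₁∈ E₂∈ E₃∈ E₄∈ 1∈₁ 3∈₁ 1∈₂ 5∈₂ 2∈₃ 3∈₃ 2∈₄ 4∈₄ u →
      ¬≻ (pattern-embedding 1<2 2<3 3<4 4<5 E₁∈ E₂∈ E₃∈ E₄∈ 1∈₁ 3∈₁ 1∈₂ 5∈₂ 2∈₃ 3∈₃ 2∈₄ 4∈₄ u)
  }

-- Every edge is nonempty. This carries the lower bound from edges over to incidences.
edg≤inc : ∀ {H} → WellFormed H → edg H ≤ inc H
edg≤inc [] = z≤n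
edg≤inc ((nonEmpty , _) ∷ wf) = +-mono-≤ (s≤s z≤n) (edg≤inc wf)

-- The lower bound

-- The equation v = N + (u - 2^k) written without subtraction.
Shift : ℕ → ℕ → ℕ → Set
Shift N u v = ∃[ k ] (u + N ≡ v + 2 ^ k)

module Construction (h : ℕ) (1≤h : 1 ≤ h) where

  -- The number of powers of two that do not exceed `h`.
  K : ℕ
  K = 1 + ⌊log₂ h ⌋

  edge : ℕ × ℕ → Edge
  edge (k , y) = y + 2 ^ k ∷ 2 * h + y ∷ []

  H₀ : Hypergraph
  H₀ = map edge (cartesianProduct (upTo K) (upTo h))

  edge-injective : ∀ {p q} → edge p ≡ edge q → p ≡ q
  edge-injective {k , y} {l , z} eq
    with y+2^k≡ , rest ← List.∷-injective eq
    with refl ← +-cancelˡ-≡ (2 * h) y z (proj₁ (List.∷-injective rest)) =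
    cong (_, y) (trans (sym (⌊log₂[2^n]⌋≡n k))
      (trans (cong ⌊log₂_⌋ (+-cancelˡ-≡ y (2 ^ k) (2 ^ l) y+2^k≡)) (⌊log₂[2^n]⌋≡n l)))

  edge-spec : ∀ {E} → E ∈ H₀ → ∃[ k ] ∃[ y ] (k < K × y < h × E ≡ edge (k , y))
  edge-spec E∈ with (k , y) , ky∈ , E≡ ← ∈-map⁻ edge E∈
               with k∈ , y∈ ← ∈-cartesianProduct⁻ (upTo K) (upTo h) ky∈ =
    k , y , ∈-upTo⁻ k∈ , ∈-upTo⁻ y∈ , E≡

  2^k≤h : ∀ {k} → k < K → 2 ^ k ≤ h
  2^k≤h k<K = ≤-trans (^-monoʳ-≤ 2 (≤-pred k<K)) (2^⌊log₂⌋≤ h 1≤h)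

  left<right : ∀ {k} y → k < K → y + 2 ^ k < 2 * h + y
  left<right {k} y k<K = begin-strict
    y + 2 ^ k    ≤⟨ +-monoʳ-≤ y (2^k≤h k<K) ⟩
    y + h        <⟨ +-monoʳ-< y (m<m+n h (≤-trans 1≤h (m≤m+n h 0))) ⟩
    y + 2 * h    ≡⟨ +-comm y (2 * h) ⟩
    2 * h + y    ∎
    where open ≤-Reasoning

  right<4h : ∀ {y} → y < h → 2 * h + y < 4 * h
  right<4h {y} y<h = begin-strict
    2 * h + y        <⟨ +-monoʳ-< (2 * h) y<h ⟩
    2 * h + h        ≤⟨ +-monoʳ-≤ (2 * h) (m≤m+n h _) ⟩
    2 * h + 2 * h    ≡⟨ *-distribʳ-+ h 2 2 ⟨
    4 * h            ∎
    where open ≤-Reasoning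

  wellFormed : WellFormed H₀
  wellFormed = All.tabulate λ E∈ → well (edge-spec E∈)
    where
    well : ∀ {E} → ∃[ k ] ∃[ y ] (k < K × y < h × E ≡ edge (k , y)) → IsEdge E
    well (k , y , k<K , _ , refl) = nonEmpty , left<right y k<K ∷ [-]

  simple : Simple H₀
  simple = map⁺ edge-injective (cartesianProduct⁺ (upTo⁺ K) (upTo⁺ h))

  vtx≤ : vtx H₀ ≤ 4 * h
  vtx≤ = subst (vtx H₀ ≤_) (length-upTo (4 * h))
    (unique-⊆⇒length-≤ (Dedup.deduplicate-! _≟_ (concat H₀)) λ x∈ →
      let E , x∈E , E∈ = ∈-concat⁻′ H₀ (∈-deduplicate⁻ _≟_ (concat H₀) x∈)
      in ∈-upTo⁺ (small (edge-spec E∈) x∈E))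
    where
    small : ∀ {E x} → ∃[ k ] ∃[ y ] (k < K × y < h × E ≡ edge (k , y)) → x ∈ E → x < 4 * h
    small (k , y , k<K , y<h , refl) (here refl) = <-trans (left<right y k<K) (right<4h y<h)
    small (k , y , k<K , y<h , refl) (there (here refl)) = right<4h y<h

  -- The left end of an edge is the smaller one, so `u < v` tells the two ends apart.
  edge-ends : ∀ {E u v} → E ∈ H₀ → u ∈ E → v ∈ E → u < v → Shift (2 * h) u v
  edge-ends E∈ u∈ v∈ u<v with k , y , k<K , y<h , refl ← edge-spec E∈ = k , ends u∈ v∈ u<v
    where
    ends : ∀ {u v} → u ∈ edge (k , y) → v ∈ edge (k , y) → u < v → u + 2 * h ≡ v + 2 ^ k
    ends (here refl) (here refl) u<u = ⊥-elim (<-irrefl refl u<u)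
    ends (here refl) (there (here refl)) _ =
      solve 3 (λ y p h → y :+ p :+ h := h :+ y :+ p) refl y (2 ^ k) (2 * h)
      where open +-*-Solver
    ends (there (here refl)) (here refl) v<u = ⊥-elim (<-asym v<u (left<right y k<K))
    ends (there (here refl)) (there (here refl)) u<u = ⊥-elim (<-irrefl refl u<u)

  -- From a₃, the vertex a₄ is at distance 2^r − 2^s ≥ 2^(r−1) ≥ 2^p, while a₅ is at distance 2^p − 2^q.
  no-pattern : ∀ {N a₁ a₂ a₃ a₄ a₅} → a₁ < a₂ → a₃ < a₄ → a₄ < a₅ →
    Shift N a₁ a₃ → Shift N a₁ a₅ → Shift N a₂ a₃ → Shift N a₂ a₄ → ⊥
  no-pattern {N} {a₁} {a₂} {a₃} {a₄} {a₅} 1<2 3<4 4<5 (p , e₁) (q , e₂) (r , e₃) (s , e₄) =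
    <-irrefl refl (<-≤-trans 4<5 (≤-trans (m≤m+n a₅ (2 ^ q)) a₅+2^q≤a₄))
    where
    open ≤-Reasoning
    open +-*-Solver
    2^-cancel : ∀ m n → 2 ^ m < 2 ^ n → 2 * 2 ^ m ≤ 2 ^ n
    2^-cancel m n lt = ^-monoʳ-≤ 2 {suc m} {n} (≰⇒> λ n≤m → <⇒≱ lt (^-monoʳ-≤ 2 n≤m))
    2·2^p≤2^r : 2 * 2 ^ p ≤ 2 ^ r
    2·2^p≤2^r = 2^-cancel p r (+-cancelˡ-< a₃ _ _ (subst₂ _<_ e₁ e₃ (+-monoˡ-< N 1<2)))
    2·2^s≤2^r : 2 * 2 ^ s ≤ 2 ^ r
    2·2^s≤2^r = 2^-cancel s r (+-cancelˡ-< a₄ _ _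
      (<-≤-trans (≤-reflexive (cong suc (trans (sym e₄) e₃))) (+-monoˡ-< (2 ^ r) 3<4)))
    a₅+2^q≤a₄ : a₅ + 2 ^ q ≤ a₄
    a₅+2^q≤a₄ = *-cancelˡ-≤ 2 (+-cancelʳ-≤ (2 ^ r) _ _ (begin
      2 * (a₅ + 2 ^ q) + 2 ^ r        ≡⟨ cong (λ x → 2 * x + 2 ^ r) (trans (sym e₂) e₁) ⟩
      2 * (a₃ + 2 ^ p) + 2 ^ r        ≡⟨ cong (_+ 2 ^ r) (*-distribˡ-+ 2 a₃ (2 ^ p)) ⟩
      2 * a₃ + 2 * 2 ^ p + 2 ^ r      ≤⟨ +-monoˡ-≤ (2 ^ r) (+-monoʳ-≤ (2 * a₃) 2·2^p≤2^r) ⟩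
      2 * a₃ + 2 ^ r + 2 ^ r          ≡⟨ solve 2 (λ a x → con 2 :* a :+ x :+ x := con 2 :* (a :+ x)) refl a₃ (2 ^ r) ⟩
      2 * (a₃ + 2 ^ r)                ≡⟨ cong (2 *_) (trans (sym e₃) e₄) ⟩
      2 * (a₄ + 2 ^ s)                ≡⟨ *-distribˡ-+ 2 a₄ (2 ^ s) ⟩
      2 * a₄ + 2 * 2 ^ s              ≤⟨ +-monoʳ-≤ (2 * a₄) 2·2^s≤2^r ⟩
      2 * a₄ + 2 ^ r                  ∎))

  G₁-free : H₀ ≻ G₁ → ⊥
  G₁-free (φ , f , mono , _ , _ , contains) =
    no-pattern {N = 2 * h} φ1<φ2 φ3<φ4 φ4<φ5
      (ends fzero (here refl) (there (here refl)) φ1<φ3)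
      (ends (fsuc fzero) (here refl) (there (here refl)) (<-trans φ1<φ3 (<-trans φ3<φ4 φ4<φ5)))
      (ends (fsuc (fsuc fzero)) (here refl) (there (here refl)) φ2<φ3)
      (ends (fsuc (fsuc (fsuc fzero))) (here refl) (there (here refl)) (<-trans φ2<φ3 φ3<φ4))
    where
    φ< : ∀ u v {_ : True (u ∈? concat G₁)} {_ : True (v ∈? concat G₁)} → u < v → φ u < φ v
    φ< u v {u∈} {v∈} = mono u v (toWitness u∈) (toWitness v∈)
    φ1<φ2 : φ 1 < φ 2
    φ1<φ2 = φ< 1 2 (n<1+n 1)
    φ2<φ3 : φ 2 < φ 3
    φ2<φ3 = φ< 2 3 (n<1+n 2)
    φ3<φ4 : φ 3 < φ 4
    φ3<φ4 = φ< 3 4 (n<1+n 3)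
    φ4<φ5 : φ 4 < φ 5
    φ4<φ5 = φ< 4 5 (n<1+n 4)
    φ1<φ3 : φ 1 < φ 3
    φ1<φ3 = <-trans φ1<φ2 φ2<φ3
    ends : ∀ i {u v} → u ∈ lookup G₁ i → v ∈ lookup G₁ i → φ u < φ v → Shift (2 * h) (φ u) (φ v)
    ends i u∈ v∈ = edge-ends (∈-lookup (f i)) (contains i _ u∈) (contains i _ v∈)

  admissible : ∀ {n} → 4 * h ≤ n → Admissible G₁ n H₀
  admissible 4h≤n = wellFormed , simple , ≤-trans vtx≤ 4h≤n , G₁-free

  edg-H₀ : edg H₀ ≡ K * h
  edg-H₀ = trans (length-map edge (cartesianProduct (upTo K) (upTo h)))
    (trans (length-cartesianProduct (upTo K) (upTo h)) (cong₂ _*_ (length-upTo K) (length-upTo h)))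

lower-bound : ∀ n → 4 ≤ n → ∃[ H ] (Admissible G₁ n H × nlogn n < 24 * edg H)
lower-bound n 4≤n = H₀ , admissible (subst (_≤ n) (*-comm h 4) (m/n*n≤m n 4)) , (begin-strict
  n * lg n              ≤⟨ *-monoʳ-≤ n lg≤ ⟩
  n * (3 * K)           <⟨ *-monoˡ-< (3 * K) n<8h ⟩
  8 * h * (3 * K)       ≡⟨ solve 2 (λ h K → con 8 :* h :* (con 3 :* K) := con 24 :* (K :* h)) refl h K ⟩
  24 * (K * h)          ≡⟨ cong (24 *_) edg-H₀ ⟨
  24 * edg H₀           ∎)
  where
  open ≤-Reasoning
  open +-*-Solver
  -- With h = ⌊n / 4⌋ the construction fits on `n` vertices, and n < 8 h because h ≥ 1. Since lg n ≤
  -- 3 + ⌊log₂ h⌋ ≤ 3 K, the constant is 24 = 8 * 3.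
  h : ℕ
  h = n / 4
  1≤h : 1 ≤ h
  1≤h = m≥n⇒m/n>0 4≤n
  open Construction h 1≤h
  instance
    h≢0 : NonZero h
    h≢0 = >-nonZero 1≤h
    2h≢0 : NonZero (2 * h)
    2h≢0 = m*n≢0 2 h
    4h≢0 : NonZero (2 * (2 * h))
    4h≢0 = m*n≢0 2 (2 * h)
  n<8h : n < 8 * h
  n<8h = begin-strict
    n                  ≡⟨ m≡m%n+[m/n]*n n 4 ⟩
    n % 4 + h * 4      <⟨ +-monoˡ-< (h * 4) (m%n<n n 4) ⟩
    4 + h * 4          ≤⟨ +-monoˡ-≤ (h * 4) (*-monoʳ-≤ 4 1≤h) ⟩
    4 * h + h * 4      ≡⟨ solve 1 (λ h → con 4 :* h :+ h :* con 4 := con 8 :* h) refl h ⟩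
    8 * h              ∎
  lg≤ : lg n ≤ 3 * K
  lg≤ = begin
    ⌊log₂ n ⌋                       ≤⟨ ⌊log₂⌋-mono-≤ (<⇒≤ n<8h) ⟩
    ⌊log₂ 8 * h ⌋                   ≡⟨ cong ⌊log₂_⌋ (solve 1 (λ h → con 8 :* h := con 2 :* (con 2 :* (con 2 :* h))) refl h) ⟩
    ⌊log₂ 2 * (2 * (2 * h)) ⌋       ≡⟨ ⌊log₂[2*b]⌋≡1+⌊log₂b⌋ (2 * (2 * h)) ⟩
    1 + ⌊log₂ 2 * (2 * h) ⌋         ≡⟨ cong suc (⌊log₂[2*b]⌋≡1+⌊log₂b⌋ (2 * h)) ⟩
    2 + ⌊log₂ 2 * h ⌋               ≡⟨ cong (2 +_) (⌊log₂[2*b]⌋≡1+⌊log₂b⌋ h) ⟩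
    2 + K                           ≤⟨ +-monoˡ-≤ K (*-monoʳ-≤ 2 (s≤s (z≤n {⌊log₂ h ⌋}))) ⟩
    2 * K + K                       ≡⟨ solve 1 (λ K → con 2 :* K :+ K := con 3 :* K) refl K ⟩
    3 * K                           ∎

-- From admissible hypergraphs to the extremal functions

upperFn-≥ : ∀ n → 4 ≤ n → n * square (lg n) ≤ upperFn n
upperFn-≥ n 4≤n = begin
  n * (k * k)              ≡⟨ cong (λ x → n * (k * x)) (*-identityʳ k) ⟨
  -- For n ≥ 4 the iterated logarithm `lg k` is at least 1, so multiplying by its cube cannot
  -- decrease the value.
  n * k ^ 2                ≤⟨ m≤m*n (n * k ^ 2) (lg k ^ 3) ⟩
  n * k ^ 2 * lg k ^ 3     ∎
  where
  open ≤-Reasoning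
  k : ℕ
  k = lg n
  instance
    _ = m^n≢0 (lg k) 3 ⦃ >-nonZero (⌊log₂⌋-mono-≤ (⌊log₂⌋-mono-≤ 4≤n)) ⦄

upperFn>0 : ∀ n → 4 ≤ n → 0 < upperFn n
upperFn>0 n 4≤n = ≤-trans
  (*-mono-≤ (≤-trans (s≤s z≤n) 4≤n) (*-mono-≤ 1≤lg 1≤lg)) (upperFn-≥ n 4≤n)
  where
  1≤lg : 1 ≤ lg n
  1≤lg = ⌊log₂⌋-mono-≤ (≤-trans (s≤s (s≤s z≤n)) 4≤n)

-- The maximum is attained, so a bound valid for all admissible hypergraphs applies to it.
≪-max : ∀ {g} c (w : Hypergraph → ℕ) (ex : ℕ → ℕ) → (∀ n → IsMaxOf w G₁ n (ex n)) →
        (∀ n H → 4 ≤ n → Admissible G₁ n H → w H < c * g n) → ex ≪ g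
≪-max {g} c w ex isMax w< = c , 4 , λ n 4≤n →
  let (H , adm , w≡) , _ = isMax n in subst (_< c * g n) w≡ (w< n H 4≤n adm)

-- The maximum dominates every admissible hypergraph, in particular the constructed one.
max-≫ : (w : Hypergraph → ℕ) (ex : ℕ → ℕ) → (∀ n → IsMaxOf w G₁ n (ex n)) →
        (∀ {H} → WellFormed H → edg H ≤ w H) → nlogn ≪ ex
max-≫ w ex isMax edg≤w = 24 , 4 , λ n 4≤n →
  let H , adm , lt = lower-bound n 4≤n in
  <-≤-trans lt (*-monoʳ-≤ 24 (≤-trans (edg≤w (proj₁ adm)) (proj₂ (isMax n) H adm)))

module _ (D : ℕ) (bound : ∀ n → 2 ≤ n → Bound n (D * (n * square (lg n)))) where

  private
    D<c : ∀ n → 4 ≤ n → 19 * (D * (n * square (lg n))) < (1 + 19 * D) * upperFn n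
    D<c n 4≤n = begin-strict
      19 * (D * (n * square (lg n)))    ≤⟨ *-monoʳ-≤ 19 (*-monoʳ-≤ D (upperFn-≥ n 4≤n)) ⟩
      19 * (D * upperFn n)              ≡⟨ *-assoc 19 D (upperFn n) ⟨
      -- The additional 1 in the constant makes the inequality strict, as `upperFn n` is positive.
      19 * D * upperFn n                <⟨ m<n+m _ (upperFn>0 n 4≤n) ⟩
      (1 + 19 * D) * upperFn n          ∎
      where open ≤-Reasoning

  upper-bound-edg : ∀ n H → 4 ≤ n → Admissible G₁ n H → edg H < (1 + 19 * D) * upperFn n
  upper-bound-edg n H 4≤n adm =
    let V , V≤n , fam = admissible-family adm in
    -- A factor 19 is given away, so that edges and incidences share one constant.
    ≤-<-trans (bound n (≤-trans (s≤s (s≤s z≤n)) 4≤n) V≤n fam) (≤-<-trans (m≤n*m _ 19) (D<c n 4≤n))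

  upper-bound-inc : ∀ n H → 4 ≤ n → Admissible G₁ n H → inc H < (1 + 19 * D) * upperFn n
  upper-bound-inc n H 4≤n adm =
    let V , V≤n , fam = admissible-family adm in
    ≤-<-trans (inc-bound fam V≤n (bound n (≤-trans (s≤s (s≤s z≤n)) 4≤n))) (D<c n 4≤n)

  bounds : (exe exi : ℕ → ℕ) → (∀ n → IsExE G₁ n (exe n)) → (∀ n → IsExI G₁ n (exi n)) →
    ((nlogn ≪ exe) × (exe ≪ upperFn)) × ((nlogn ≪ exi) × (exi ≪ upperFn))
  bounds exe exi isExe isExi =
    (max-≫ edg exe isExe (λ _ → ≤-refl) , ≪-max (1 + 19 * D) edg exe isExe upper-bound-edg) ,
    (max-≫ inc exi isExi edg≤inc , ≪-max (1 + 19 * D) inc exi isExi upper-bound-inc)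

theorem3 : (exe exi : ℕ → ℕ) →
    (∀ n → IsExE G₁ n (exe n)) →
    (∀ n → IsExI G₁ n (exi n)) →
    ((nlogn ≪ exe) × (exe ≪ upperFn)) × ((nlogn ≪ exi) × (exi ≪ upperFn))
theorem3 = bounds (proj₁ edges-quasilinear) (proj₂ edges-quasilinear)
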